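{- Let $n\geq l\geq 3$ be integers. If $G$ is an $n$-vertex unicyclic graph with girth $l$, then $$n(US_n^l)\geq n(G)\geq n(UP_n^l).$$
   Context: A unicyclic graph is a connected graph containing exactly one cycle; its girth is the length of that cycle. A subtree of a graph $G$ is a subgraph of $G$ that is a tree (subtrees are distinguished as subgraphs); $n(G)$ is the number of subtrees of $G$, counting also the empty subtree. $US_n^l$ is the graph obtained from the cycle $C_l$ by attaching $n-l$ pendent vertices to one vertex of the cycle. $UP_n^l$ is the graph obtained from $C_l$ by attaching a pendent path of length $n-l$ to one vertex of the cycle (i.e. identifying a cycle vertex with an end vertex of a path with $n-l$ edges whose other vertices are new). -}

module Defs where

open import Data.Bool using (true; false)
open import Data.Empty using (⊥-elim)
open import Data.Fin using (Fin; toℕ)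
open import Data.Fin.Properties using (_≟_; all?; any?; injective⇒≤)
open import Data.Fin.Subset using (Subset; _∈_)
open import Data.Fin.Subset.Properties using (_∈?_)
open import Data.List using (List; []; _∷_; _∷ʳ_; length; zip; filter; cartesianProductWith; allFin; lookup)
import Data.List.Membership.Propositional as ListMem
open import Data.List.Membership.Propositional.Properties using (∈-allFin; ∈-lookup)
open import Data.List.Relation.Unary.All as All using (All)
open import Data.List.Relation.Unary.AllPairs using (_∷_)
open import Data.List.Relation.Unary.Any using (here; there)
open import Data.List.Relation.Unary.Unique.Propositional using (Unique)
import Data.List.Relation.Unary.Unique.DecPropositional as DecUnique
open import Data.Nat as ℕ using (ℕ; zero; suc; _≤_; _<_; z≤n; s≤s)
import Data.Nat.Properties as ℕₚ
open import Data.Product using (∃; _×_; _,_; uncurry)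
open import Data.Sum using (_⊎_; inj₁; inj₂; swap; [_,_])
open import Data.Vec as Vec using (Vec)
open import Function using (_⇔_; _∘_)
open import Level using (0ℓ)
open import Relation.Binary using (Rel; Decidable; Symmetric; Irreflexive)
open import Relation.Binary.Construct.Closure.ReflexiveTransitive using (Star; ε; _◅_)
open import Relation.Binary.PropositionalEquality using (_≡_; refl; sym; cong)
open import Relation.Nullary using (¬_; Dec; yes; no; ¬?; contradiction)
open import Relation.Nullary.Decidable using (map′; _×-dec_; _⊎-dec_; _→-dec_)
open import Relation.Unary as U using (Pred)

private
  variable
    n : ℕ

-- Simple graphs with vertex set Fin n.
record Graph (n : ℕ) : Set₁ where
  field
    Adj    : Rel (Fin n) 0ℓ
    adj?   : Decidable Adj
    symm   : Symmetric Adj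
    irrefl : Irreflexive _≡_ Adj

open Graph public

-- The notions below take the vertex set P and the adjacency relation E
-- separately, so that they apply both to a graph and to its subgraphs.

Connected : Pred (Fin n) 0ℓ → Rel (Fin n) 0ℓ → Set
Connected P E = ∀ u v → P u → P v → Star E u v

-- arcs (v₁ ∷ … ∷ vₖ ∷ []) = (v₁ , v₂) ∷ … ∷ (vₖ₋₁ , vₖ) ∷ (vₖ , v₁) ∷ []
arcs : {A : Set} → List A → List (A × A)
arcs []       = []
arcs (v ∷ vs) = zip (v ∷ vs) (vs ∷ʳ v)

record IsCycle (E : Rel (Fin n) 0ℓ) (c : List (Fin n)) : Set where
  constructor mkIsCycle
  field
    long     : 3 ≤ length c
    distinct : Unique c
    adjacent : All (uncurry E) (arcs c)

-- Two vertex sequences traverse the same cycle (as a subgraph) when they have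
-- the same undirected edges; starting point and direction are irrelevant.
CycleEdge : List (Fin n) → Rel (Fin n) 0ℓ
CycleEdge c u v = (u , v) ListMem.∈ arcs c ⊎ (v , u) ListMem.∈ arcs c

SameCycle : Rel (List (Fin n)) 0ℓ
SameCycle c d = ∀ u v → CycleEdge c u v ⇔ CycleEdge d u v

record Unicyclic (G : Graph n) : Set where
  field
    connected : Connected U.U (Adj G)
    cycle     : List (Fin n)
    isCycle   : IsCycle (Adj G) cycle
    unique    : ∀ c → IsCycle (Adj G) c → SameCycle c cycle

  girth : ℕ
  girth = length cycle

open Unicyclic public using (girth)

record IsTree (P : Pred (Fin n) 0ℓ) (E : Rel (Fin n) 0ℓ) : Set where
  constructor mkIsTree
  field
    nonempty  : ∃ P
    connected : Connected P E
    acyclic   : ¬ ∃ (IsCycle E)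

-- Candidate subgraphs: a vertex set and the neighbourhood of each vertex.
-- Distinct subgraphs are exactly the propositionally distinct values.
record PreSubgraph (n : ℕ) : Set where
  constructor mkPreSubgraph
  field
    vertices   : Subset n
    neighbours : Vec (Subset n) n

  Vertex : Pred (Fin n) 0ℓ
  Vertex u = u ∈ vertices

  Edge : Rel (Fin n) 0ℓ
  Edge u v = v ∈ Vec.lookup neighbours u

open PreSubgraph public

record IsSubgraph (G : Graph n) (H : PreSubgraph n) : Set where
  constructor mkIsSubgraph
  field
    edge-sym    : ∀ u v → Edge H u v → Edge H v u
    edge-vertex : ∀ u v → Edge H u v → Vertex H u
    edge-adj    : ∀ u v → Edge H u v → Adj G u v

record IsSubtree (G : Graph n) (H : PreSubgraph n) : Set where
  constructor mkIsSubtree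
  field
    isSubgraph : IsSubgraph G H
    isTree     : IsTree (Vertex H) (Edge H)

-- Decidability of being a subtree.

-- Nonempty walks all of whose intermediate vertices lie in ws.
data Via (E : Rel (Fin n) 0ℓ) (ws : List (Fin n)) : Rel (Fin n) 0ℓ where
  direct : ∀ {u v} → E u v → Via E ws u v
  step   : ∀ {u w v} → E u w → w ListMem.∈ ws → Via E ws w v → Via E ws u v

module _ {E : Rel (Fin n) 0ℓ} where

  private
    weaken : ∀ {x ws u v} → Via E ws u v → Via E (x ∷ ws) u v
    weaken (direct e)   = direct e
    weaken (step e m p) = step e (there m) (weaken p)

    join : ∀ {x ws u v} → Via E (x ∷ ws) u x → Via E (x ∷ ws) x v → Via E (x ∷ ws) u v
    join (direct e)   q = step e (here refl) q
    join (step e m p) q = step e m (join p q)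

    split : ∀ {x ws u v} → Via E (x ∷ ws) u v →
            Via E ws u v ⊎ (Via E ws u x × Via E ws x v)
    split (direct e) = inj₁ (direct e)
    split (step e (here refl) p) with split p
    ... | inj₁ q       = inj₂ (direct e , q)
    ... | inj₂ (_ , q) = inj₂ (direct e , q)
    split (step e (there m) p) with split p
    ... | inj₁ q       = inj₁ (step e m q)
    ... | inj₂ (q , r) = inj₂ (step e m q , r)

    toStar : ∀ {ws u v} → Via E ws u v → Star E u v
    toStar (direct e)   = e ◅ ε
    toStar (step e _ p) = e ◅ toStar p

    fromStar : ∀ {u v} → Star E u v → u ≡ v ⊎ Via E (allFin n) u v
    fromStar ε = inj₁ refl
    fromStar (e ◅ es) with fromStar es
    ... | inj₁ refl = inj₂ (direct e)
    ... | inj₂ p    = inj₂ (step e (∈-allFin _) p)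

  module _ (E? : Decidable E) where

    via? : ∀ ws → Decidable (Via E ws)
    via? [] u v = map′ direct (λ { (direct e) → e ; (step _ () _) }) (E? u v)
    via? (x ∷ ws) u v =
      map′ [ weaken , (λ (p , q) → join (weaken p) (weaken q)) ] split
           (via? ws u v ⊎-dec (via? ws u x ×-dec via? ws x v))

    star? : Decidable (Star E)
    star? u v = map′ [ (λ { refl → ε }) , toStar ] fromStar
                     (u ≟ v ⊎-dec via? (allFin n) u v)

    connected? : {P : Pred (Fin n) 0ℓ} → U.Decidable P → Dec (Connected P E)
    connected? P? = all? λ u → all? λ v → P? u →-dec (P? v →-dec star? u v)

    isCycle? : U.Decidable (IsCycle E)
    isCycle? c =
      map′ (λ (l , d , a) → mkIsCycle l d a) (λ (mkIsCycle l d a) → l , d , a)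
           (3 ℕ.≤? length c ×-dec (DecUnique.unique? _≟_ c ×-dec
             All.all? (λ (u , v) → E? u v) (arcs c)))

private
  shortList? : {Q : Pred (List (Fin n)) 0ℓ} → U.Decidable Q → ∀ b →
               Dec (∃ λ c → length c ≤ b × Q c)
  shortList? Q? zero =
    map′ (λ q → [] , z≤n , q) (λ { ([] , _ , q) → q }) (Q? [])
  shortList? {Q = Q} Q? (suc b) =
    map′ to from (Q? [] ⊎-dec any? λ x → shortList? (Q? ∘ (x ∷_)) b)
    where
    to : Q [] ⊎ ∃ (λ x → ∃ λ c → length c ≤ b × Q (x ∷ c)) → ∃ λ c → length c ≤ suc b × Q c
    to (inj₁ q)               = [] , z≤n , q
    to (inj₂ (x , c , l , q)) = x ∷ c , s≤s l , q
    from : (∃ λ c → length c ≤ suc b × Q c) → Q [] ⊎ ∃ (λ x → ∃ λ c → length c ≤ b × Q (x ∷ c))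
    from ([] , _ , q)        = inj₁ q
    from (x ∷ c , s≤s l , q) = inj₂ (x , c , l , q)

  lookup-inj : {c : List (Fin n)} → Unique c → ∀ {i j} → lookup c i ≡ lookup c j → i ≡ j
  lookup-inj (_ ∷ _) {Fin.zero} {Fin.zero} _ = refl
  lookup-inj (a ∷ _) {Fin.zero} {Fin.suc j} e = ⊥-elim (All.lookup a (∈-lookup j) e)
  lookup-inj (a ∷ _) {Fin.suc i} {Fin.zero} e = ⊥-elim (All.lookup a (∈-lookup i) (sym e))
  lookup-inj (_ ∷ u) {Fin.suc i} {Fin.suc j} e = cong Fin.suc (lookup-inj u e)

hasCycle? : {E : Rel (Fin n) 0ℓ} → Decidable E → Dec (∃ (IsCycle E))
hasCycle? {n} E? =
  map′ (λ (c , _ , p) → c , p)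
       (λ (c , p) → c , injective⇒≤ (lookup-inj (IsCycle.distinct p)) , p)
       (shortList? (isCycle? E?) n)

isTree? : {P : Pred (Fin n) 0ℓ} {E : Rel (Fin n) 0ℓ} →
          U.Decidable P → Decidable E → Dec (IsTree P E)
isTree? P? E? =
  map′ (λ (p , c , a) → mkIsTree p c a) (λ (mkIsTree p c a) → p , c , a)
       (any? P? ×-dec (connected? E? P? ×-dec ¬? (hasCycle? E?)))

vertex? : (H : PreSubgraph n) → U.Decidable (Vertex H)
vertex? H u = u ∈? vertices H

edge? : (H : PreSubgraph n) → Decidable (Edge H)
edge? H u v = v ∈? Vec.lookup (neighbours H) u

isSubgraph? : (G : Graph n) → U.Decidable (IsSubgraph G)
isSubgraph? G H =
  map′ (λ (s , v , a) → mkIsSubgraph s v a) (λ (mkIsSubgraph s v a) → s , v , a)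
       ((all? λ u → all? λ v → edge? H u v →-dec edge? H v u) ×-dec
        ((all? λ u → all? λ v → edge? H u v →-dec vertex? H u) ×-dec
         (all? λ u → all? λ v → edge? H u v →-dec adj? G u v)))

isSubtree? : (G : Graph n) → U.Decidable (IsSubtree G)
isSubtree? G H =
  map′ (λ (s , t) → mkIsSubtree s t) (λ (mkIsSubtree s t) → s , t)
       (isSubgraph? G H ×-dec isTree? (vertex? H) (edge? H))

-- If xs lists every element of A exactly once, then allVecs xs k does so for Vec A k.
allVecs : {A : Set} → List A → ∀ k → List (Vec A k)
allVecs xs zero    = Vec.[] ∷ []
allVecs xs (suc k) = cartesianProductWith Vec._∷_ xs (allVecs xs k)

allSubsets : ∀ n → List (Subset n)
allSubsets = allVecs (false ∷ true ∷ [])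

allPreSubgraphs : ∀ n → List (PreSubgraph n)
allPreSubgraphs n = cartesianProductWith mkPreSubgraph (allSubsets n) (allVecs (allSubsets n) n)

-- The suc accounts for the empty subtree, which IsTree excludes.
numSubtrees : Graph n → ℕ
numSubtrees {n} G = suc (length (filter (isSubtree? G) (allPreSubgraphs n)))

-- The graph on Fin n whose edges are given by a relation on the numbers below n,
-- each edge listed in at least one direction.
fromRel : (R : Rel ℕ 0ℓ) → Decidable R → (∀ i → ¬ R i i) → ∀ n → Graph n
fromRel R R? irr n = record
  { Adj    = λ u v → R (toℕ u) (toℕ v) ⊎ R (toℕ v) (toℕ u)
  ; adj?   = λ u v → R? (toℕ u) (toℕ v) ⊎-dec R? (toℕ v) (toℕ u)
  ; symm   = swap
  ; irrefl = λ { refl → [ irr _ , irr _ ] }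
  }

-- The cycle 0, 1, …, l - 1, 0.
CycleArc : ℕ → Rel ℕ 0ℓ
CycleArc l i j = (suc i ≡ j × j < l) ⊎ (suc i ≡ l × j ≡ 0)

-- Vertices l, l + 1, … are pendent at the cycle vertex 0.
StarArc : ℕ → Rel ℕ 0ℓ
StarArc l i j = i ≡ 0 × l ≤ j

-- The pendent path l - 1, l, l + 1, … starts at the cycle vertex l - 1.
PathArc : ℕ → Rel ℕ 0ℓ
PathArc l i j = suc i ≡ j × l ≤ j

private
  cycleArc? : ∀ l → Decidable (CycleArc l)
  cycleArc? l i j = (suc i ℕ.≟ j ×-dec j ℕ.<? l) ⊎-dec (suc i ℕ.≟ l ×-dec j ℕ.≟ 0)

  cycleArc-irrefl : ∀ {l} → 3 ≤ l → ∀ i → ¬ CycleArc l i i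
  cycleArc-irrefl _ i (inj₁ (e , _)) = ℕₚ.1+n≢n e
  cycleArc-irrefl (s≤s ()) .0 (inj₂ (refl , refl))

US : ∀ n l → 3 ≤ l → Graph n
US n l 3≤l = fromRel (λ i j → CycleArc l i j ⊎ StarArc l i j)
  (λ i j → cycleArc? l i j ⊎-dec (i ℕ.≟ 0 ×-dec l ℕ.≤? j))
  (λ i → [ cycleArc-irrefl 3≤l i
         , (λ { (refl , l≤0) → contradiction (ℕₚ.≤-trans 3≤l l≤0) λ () }) ])
  n

UP : ∀ n l → 3 ≤ l → Graph n
UP n l 3≤l = fromRel (λ i j → CycleArc l i j ⊎ PathArc l i j)
  (λ i j → cycleArc? l i j ⊎-dec (suc i ℕ.≟ j ×-dec l ℕ.≤? j))
  (λ i → [ cycleArc-irrefl 3≤l i , (λ (e , _) → ℕₚ.1+n≢n e) ])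
  n

{-# OPTIONS --safe #-}

-- Grow the vertex set of G from its cycle c by adding leaves one at a time, and let N(S; T)
-- count the subtrees inside S whose vertex set contains T.  If v is a leaf of S ∪ {v} with
-- neighbour w, then N(S ∪ {v}; T) = N(S; T) + N(S ∪ {v}; T ∪ {v}) and
-- N(S ∪ {v}; {v}) = 1 + N(S; {w}).  For u in S, a spanning tree of S ∪ {v} and the removal of v
-- show 1 ≤ N(S ∪ {v}; {u, v}) ≤ N(S; {u}), with equality on the right when u = w.  So if S arises
-- from c by k steps and t = N(c; {u}), which is the same for all vertices u of c, then
-- k + t ≤ N(S; {u}) ≤ 2ᵏ t for all u in S.  Summing over the steps bounds N(S; ∅); in US every
-- leaf is attached to the vertex attaining 2ᵏ t, in UP to the one attaining k + t.

module Submission where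

open import Defs
open import Data.Nat using (ℕ; _≤_; _≥_)
open import Data.Product using (_×_)
open import Relation.Binary.PropositionalEquality using (_≡_)

open import Data.Bool using (if_then_else_; true; false)
open import Data.Empty using (⊥; ⊥-elim)
open import Data.Fin using (Fin; toℕ; fromℕ<)
open import Data.Fin.Properties using (_≟_; all?; ¬∀⟶∃¬; toℕ-injective; toℕ-fromℕ<; toℕ<n)
open import Data.Fin.Subset using (Subset)
open import Data.Fin.Subset.Properties using (⊆-antisym)
open import Data.List using (List; []; _∷_; _∷ʳ_; _++_; map; zip; zipWith; drop; length; filter; allFin)
open import Data.List.Properties
  using (length-++; length-++-sucʳ; length-tabulate; length-map; ++-assoc; ++-identityʳ;
         map-∘; map-++; zipWith-map; map-zipWith)
open import Data.List.Membership.Propositional using (_∈_; _∉_)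
open import Data.List.Membership.Propositional.Properties
  using (∈-map⁺; ∈-map⁻; ∈-++⁺ˡ; ∈-++⁺ʳ; ∈-++⁻; ∈-∃++;
         ∈-filter⁺; ∈-filter⁻; ∈-cartesianProductWith⁺; ∈-allFin)
import Data.List.Membership.DecPropositional as DecMembership
open import Data.List.Relation.Binary.Subset.Propositional using (_⊆_)
open import Data.List.Relation.Binary.Permutation.Propositional using (_↭_; ↭-refl; ↭-sym; ↭-trans; ↭⇒↭ₛ)
open import Data.List.Relation.Binary.Permutation.Propositional.Properties
  using (↭-length; ∈-resp-↭; All-resp-↭; ++-comm; ∷↭∷ʳ)
open import Data.List.Relation.Binary.Permutation.Setoid.Properties
  using () renaming (Unique-resp-↭ to Unique-resp-↭ₛ)
open import Data.List.Relation.Unary.All as All using (All; []; _∷_)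
import Data.List.Relation.Unary.All.Properties as Allₚ
open import Data.List.Relation.Unary.AllPairs using ([]; _∷_)
open import Data.List.Relation.Unary.Any using (here; there)
open import Data.List.Relation.Unary.Unique.Propositional using (Unique)
open import Data.List.Relation.Unary.Unique.Propositional.Properties
  using (cartesianProductWith⁺; filter⁺; allFin⁺; Unique[x∷xs]⇒x∉xs)
open import Data.Nat using (zero; suc; pred; >-nonZero; _+_; _*_; _∸_; _^_; _<_; z≤n; s≤s)
open import Data.Nat.Properties
  using (≤-refl; ≤-trans; ≤-antisym; ≤-reflexive; ≤-irrelevant; <⇒≤; <-irrefl; <-trans; <-≤-trans;
         m≤n+m; m<n⇒m<1+n; m≤n⇒m<n∨m≡n; suc-injective; suc-pred; m∸n+n≡m; +-suc; +-comm; +-identityʳ;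
         +-mono-≤; +-monoˡ-≤; +-monoʳ-≤; *-distribʳ-+; module ≤-Reasoning)
open import Data.Product using (∃; Σ; _,_; proj₁; proj₂; uncurry; swap)
open import Data.Sum as Sum using (_⊎_; inj₁; inj₂; [_,_]′)
import Data.Vec as Vec
open import Data.Vec using (Vec)
open import Data.Vec.Properties using ([]=⇒lookup; lookup⇒[]=; lookup∘tabulate; tabulate∘lookup; tabulate-cong)
open import Function using (_∘_; id; Equivalence)
open import Level using (0ℓ)
open import Relation.Binary using (Rel; Decidable)
open import Relation.Binary.Construct.Closure.ReflexiveTransitive as Star using (Star; ε; _◅_; _◅◅_)
open import Relation.Binary.PropositionalEquality
  using (_≢_; refl; sym; trans; cong; cong₂; subst; subst₂; ≢-sym; setoid; module ≡-Reasoning)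
open import Relation.Nullary using (¬_; Dec; yes; no; does; ¬?; contradiction)
open import Relation.Nullary.Decidable using (_×-dec_; _⊎-dec_; _→-dec_; dec-true; dec-false)
open import Relation.Unary as U using (Pred)

-- The places where the leaves of `G` attach, and their order, are unknown. The bounds on rooted
-- counts therefore hold at every vertex of the grown set and depend only on the number of steps,
-- which lets the totals be compared with recursions in `k` alone. These recursions start from the
-- total and the rooted count of the cycle. The three graphs share both numbers because the cycle is
-- induced in each of them; in `G` this is where uniqueness of the cycle enters, by excluding
-- chords. Uniqueness enters once more to show that a vertex adjacent to the grown set has only one
-- neighbour in it. Counts are lengths of filtered enumerations, and they are compared by injections
-- with an explicit left inverse. Only one direction is established for each extremal graph: lower
-- bounds for `US`, upper bounds for `UP`.

private
  variable
    A B : Set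
    n k : ℕ

-- Counting subgraphs

∈-remove : ∀ (as : List A) {bs x y} → y ∈ as ++ x ∷ bs → y ≢ x → y ∈ as ++ bs
∈-remove as y∈ y≢x with ∈-++⁻ as y∈
... | inj₁ y∈as         = ∈-++⁺ˡ y∈as
... | inj₂ (here y≡x)   = contradiction y≡x y≢x
... | inj₂ (there y∈bs) = ∈-++⁺ʳ as y∈bs

-- Pigeonhole. It turns injections into inequalities between counts, and it also decides when a
-- grown set has exhausted the vertices.
unique-⊆-length : {xs ys : List A} → Unique xs → xs ⊆ ys → length xs ≤ length ys
unique-⊆-length [] _ = z≤n
unique-⊆-length {xs = x ∷ xs} (x≢ ∷ uxs) sub with ∈-∃++ (sub (here refl))
... | as , bs , refl = begin
  suc (length xs)              ≤⟨ s≤s (unique-⊆-length uxs λ y∈ →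
                                    ∈-remove as (sub (there y∈)) (≢-sym (All.lookup x≢ y∈))) ⟩
  suc (length (as ++ bs))      ≡⟨ cong suc (length-++ as) ⟩
  suc (length as + length bs)  ≡⟨ sym (+-suc (length as) (length bs)) ⟩
  length as + suc (length bs)  ≡⟨ sym (length-++ as) ⟩
  length (as ++ x ∷ bs)        ∎
  where open ≤-Reasoning

map-unique : (f : A → B) {xs : List A} →
             (∀ {x y} → x ∈ xs → y ∈ xs → f x ≡ f y → x ≡ y) → Unique xs → Unique (map f xs)
map-unique f inj []          = []
map-unique f inj (x≢ ∷ uxs) =
  Allₚ.map⁺ (All.tabulate λ y∈ fx≡fy → All.lookup x≢ y∈ (inj (here refl) (there y∈) fx≡fy))
  ∷ map-unique f (λ x∈ y∈ → inj (there x∈) (there y∈)) uxs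

allVecs-unique : {xs : List A} → Unique xs → ∀ k → Unique (allVecs xs k)
allVecs-unique uxs zero    = [] ∷ []
allVecs-unique uxs (suc k) =
  cartesianProductWith⁺ Vec._∷_ (λ { refl → refl , refl }) uxs (allVecs-unique uxs k)

allVecs-complete : {xs : List A} → (∀ x → x ∈ xs) → (v : Vec A k) → v ∈ allVecs xs k
allVecs-complete all Vec.[]       = here refl
allVecs-complete all (x Vec.∷ v) = ∈-cartesianProductWith⁺ Vec._∷_ (all x) (allVecs-complete all v)

allSubsets-unique : ∀ n → Unique (allSubsets n)
allSubsets-unique = allVecs-unique (((λ ()) ∷ []) ∷ [] ∷ [])

allSubsets-complete : (S : Subset n) → S ∈ allSubsets n
allSubsets-complete = allVecs-complete λ { false → here refl ; true → there (here refl) }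

allPreSubgraphs-unique : ∀ n → Unique (allPreSubgraphs n)
allPreSubgraphs-unique n =
  cartesianProductWith⁺ mkPreSubgraph (λ { refl → refl , refl })
    (allSubsets-unique n) (allVecs-unique (allSubsets-unique n) n)

allPreSubgraphs-complete : (H : PreSubgraph n) → H ∈ allPreSubgraphs n
allPreSubgraphs-complete (mkPreSubgraph V E) =
  ∈-cartesianProductWith⁺ mkPreSubgraph (allSubsets-complete V)
    (allVecs-complete allSubsets-complete E)

count : {P : Pred (PreSubgraph n) 0ℓ} → U.Decidable P → ℕ
count {n} P? = length (filter P? (allPreSubgraphs n))

module _ {P : Pred (PreSubgraph n) 0ℓ} where

  count-inhabited : (P? : U.Decidable P) → ∃ P → 1 ≤ count P?
  count-inhabited P? (H , p) with filter P? (allPreSubgraphs n) | ∈-filter⁺ P? (allPreSubgraphs-complete H) p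
  ... | _ ∷ _ | _ = s≤s z≤n

  count-≤1 : (P? : U.Decidable P) → ∀ H₀ → (∀ H → P H → H ≡ H₀) → count P? ≤ 1
  count-≤1 P? H₀ only =
    unique-⊆-length {ys = H₀ ∷ []} (filter⁺ P? (allPreSubgraphs-unique n))
      (λ H∈ → here (only _ (proj₂ (∈-filter⁻ P? {xs = allPreSubgraphs n} H∈))))

  module _ {Q : Pred (PreSubgraph n) 0ℓ} where

    -- The left inverse is asked for only on subgraphs satisfying `P`, since `prune` and `graft`
    -- undo each other only under side conditions.
    count-≤ : (P? : U.Decidable P) (Q? : U.Decidable Q) (f g : PreSubgraph n → PreSubgraph n) →
              (∀ H → P H → Q (f H)) → (∀ H → P H → g (f H) ≡ H) → count P? ≤ count Q?
    count-≤ P? Q? f g f-Q g∘f = begin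
      length Ps            ≡⟨ sym (length-map f Ps) ⟩
      length (map f Ps)    ≤⟨ unique-⊆-length fPs-unique fPs⊆Qs ⟩
      count Q?             ∎
      where
      open ≤-Reasoning
      Ps = filter P? (allPreSubgraphs n)
      holds : ∀ {H} → H ∈ Ps → P H
      holds H∈ = proj₂ (∈-filter⁻ P? {xs = allPreSubgraphs n} H∈)
      fPs-unique : Unique (map f Ps)
      fPs-unique = map-unique f
        (λ x∈ y∈ fx≡fy → trans (sym (g∘f _ (holds x∈))) (trans (cong g fx≡fy) (g∘f _ (holds y∈))))
        (filter⁺ P? (allPreSubgraphs-unique n))
      fPs⊆Qs : map f Ps ⊆ filter Q? (allPreSubgraphs n)
      fPs⊆Qs y∈ with ∈-map⁻ f y∈
      ... | H , H∈ , refl = ∈-filter⁺ Q? (allPreSubgraphs-complete (f H)) (f-Q H (holds H∈))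

    count-mono : (P? : U.Decidable P) (Q? : U.Decidable Q) → (∀ H → P H → Q H) → count P? ≤ count Q?
    count-mono P? Q? P⇒Q = count-≤ P? Q? id id P⇒Q (λ _ _ → refl)

    count-split : (P? : U.Decidable P) (Q? : U.Decidable Q) →
      count P? ≡ count (λ H → P? H ×-dec Q? H) + count (λ H → P? H ×-dec ¬? (Q? H))
    count-split P? Q? = go (allPreSubgraphs n)
      where
      go : ∀ Hs → length (filter P? Hs) ≡
           length (filter (λ H → P? H ×-dec Q? H) Hs) + length (filter (λ H → P? H ×-dec ¬? (Q? H)) Hs)
      go [] = refl
      go (H ∷ Hs) with P? H | Q? H
      ... | no  _ | _     = go Hs
      ... | yes _ | yes _ = cong suc (go Hs)
      ... | yes _ | no  _ = trans (cong suc (go Hs)) (sym (+-suc _ _))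

-- Subgraphs given by decidable predicates

module _ {V : Pred (Fin n) 0ℓ} (V? : U.Decidable V) where

  subset : Subset n
  subset = Vec.tabulate (does ∘ V?)

  ∈-subset⁺ : ∀ {u} → V u → subset Vec.[ u ]= true
  ∈-subset⁺ {u} v = lookup⇒[]= u subset (trans (lookup∘tabulate _ u) (dec-true (V? u) v))

  ∈-subset⁻ : ∀ {u} → subset Vec.[ u ]= true → V u
  ∈-subset⁻ {u} u∈ with V? u | trans (sym (lookup∘tabulate (does ∘ V?) u)) ([]=⇒lookup u∈)
  ... | yes v | _  = v
  ... | no  _ | ()

module _ {V : Pred (Fin n) 0ℓ} {E : Rel (Fin n) 0ℓ} (V? : U.Decidable V) (E? : Decidable E) where

  preSubgraph : PreSubgraph n
  preSubgraph = mkPreSubgraph (subset V?) (Vec.tabulate λ u → subset (E? u))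

  vertex⁺ : ∀ {u} → V u → Vertex preSubgraph u
  vertex⁺ = ∈-subset⁺ V?

  vertex⁻ : ∀ {u} → Vertex preSubgraph u → V u
  vertex⁻ = ∈-subset⁻ V?

  edge⁺ : ∀ {u v} → E u v → Edge preSubgraph u v
  edge⁺ {u} {v} e = subst (Vec._[ v ]= true) (sym (lookup∘tabulate _ u)) (∈-subset⁺ (E? u) e)

  edge⁻ : ∀ {u v} → Edge preSubgraph u v → E u v
  edge⁻ {u} {v} e = ∈-subset⁻ (E? u) (subst (Vec._[ v ]= true) (lookup∘tabulate _ u) e)

-- Vertex sets and neighbourhoods are Boolean vectors, so mutual inclusion already yields
-- propositional equality.
preSubgraph-ext : {H K : PreSubgraph n} →
  (∀ {u} → Vertex H u → Vertex K u) → (∀ {u} → Vertex K u → Vertex H u) →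
  (∀ {u v} → Edge H u v → Edge K u v) → (∀ {u v} → Edge K u v → Edge H u v) → H ≡ K
preSubgraph-ext {H = H} {K} V⇒ V⇐ E⇒ E⇐ = cong₂ mkPreSubgraph (⊆-antisym V⇒ V⇐)
  (trans (sym (tabulate∘lookup (neighbours H)))
    (trans (tabulate-cong λ u → ⊆-antisym E⇒ E⇐) (tabulate∘lookup (neighbours K))))

-- Closed walks and cycles

_∈?_ : (x : Fin n) (xs : List (Fin n)) → Dec (x ∈ xs)
_∈?_ = DecMembership._∈?_ _≟_

Unique-resp-↭ : {xs ys : List A} → xs ↭ ys → Unique xs → Unique ys
Unique-resp-↭ p = Unique-resp-↭ₛ (setoid _) (↭⇒↭ₛ p)

zip-∷ʳ : ∀ (x : A) xs y z →
         zip (x ∷ xs ∷ʳ y) ((xs ∷ʳ y) ∷ʳ z) ≡ zip (x ∷ xs) (xs ∷ʳ y) ∷ʳ (y , z)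
zip-∷ʳ x []        y z = refl
zip-∷ʳ x (x′ ∷ xs) y z = cong ((x , x′) ∷_) (zip-∷ʳ x′ xs y z)

arcs-rotate₁ : ∀ (x : A) xs → arcs (x ∷ xs) ↭ arcs (xs ∷ʳ x)
arcs-rotate₁ x []       = ↭-refl
arcs-rotate₁ x (y ∷ xs) =
  subst (arcs (x ∷ y ∷ xs) ↭_) (sym (zip-∷ʳ y xs x y)) (∷↭∷ʳ (x , y) (zip (y ∷ xs) (xs ∷ʳ x)))

arcs-rotate : ∀ (xs ys : List A) → arcs (xs ++ ys) ↭ arcs (ys ++ xs)
arcs-rotate []       ys = subst (arcs ys ↭_) (cong arcs (sym (++-identityʳ ys))) ↭-refl
arcs-rotate (x ∷ xs) ys = ↭-trans (arcs-rotate₁ x (xs ++ ys))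
  (subst₂ _↭_ (cong arcs (sym (++-assoc xs ys (x ∷ [])))) (cong arcs (++-assoc ys (x ∷ []) xs))
    (arcs-rotate xs (ys ∷ʳ x)))

-- Arguments about a vertex of a cycle may thus assume that it comes first.
rotate-to : {x : A} {c : List A} → x ∈ c → ∃ λ xs → c ↭ x ∷ xs × arcs c ↭ arcs (x ∷ xs)
rotate-to x∈c with ∈-∃++ x∈c
... | as , bs , refl = bs ++ as , ++-comm as (_ ∷ bs) , arcs-rotate as (_ ∷ bs)

zip-∈ : ∀ {xs : List A} {ys : List B} {x y} → (x , y) ∈ zip xs ys → x ∈ xs × y ∈ ys
zip-∈ {xs = _ ∷ _} {_ ∷ _} (here refl) = here refl , here refl
zip-∈ {xs = _ ∷ _} {_ ∷ _} (there p∈)  with zip-∈ p∈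
... | x∈ , y∈ = there x∈ , there y∈

arcs-∈ : ∀ {c : List A} {x y} → (x , y) ∈ arcs c → x ∈ c × y ∈ c
arcs-∈ {c = v ∷ vs} a∈ with zip-∈ {xs = v ∷ vs} a∈
... | x∈ , y∈ = x∈ , ∈-resp-↭ (↭-sym (∷↭∷ʳ v vs)) y∈

arc-from : ∀ {c : List A} {x} → x ∈ c → ∃ λ y → (x , y) ∈ arcs c
arc-from x∈c with rotate-to x∈c
... | []    , _ , r = _ , ∈-resp-↭ (↭-sym r) (here refl)
... | _ ∷ _ , _ , r = _ , ∈-resp-↭ (↭-sym r) (here refl)

arc-to-last : ∀ (x : A) xs z → ∃ λ y → y ∈ x ∷ xs × (y , z) ∈ zip (x ∷ xs) (xs ∷ʳ z)
arc-to-last x []        z = x , here refl , here refl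
arc-to-last x (x′ ∷ xs) z with arc-to-last x′ xs z
... | y , y∈ , a∈ = y , there y∈ , there a∈

arcs-map : (f : A → B) (c : List A) → arcs (map f c) ≡ map (λ (x , y) → f x , f y) (arcs c)
arcs-map f []       = refl
arcs-map f (v ∷ vs) = begin
  zip (map f (v ∷ vs)) (map f vs ∷ʳ f v)               ≡⟨ cong (zip (map f (v ∷ vs))) (sym (map-++ f vs (v ∷ []))) ⟩
  zip (map f (v ∷ vs)) (map f (vs ∷ʳ v))               ≡⟨ zipWith-map _,_ f f (v ∷ vs) (vs ∷ʳ v) ⟩
  zipWith (λ x y → f x , f y) (v ∷ vs) (vs ∷ʳ v)       ≡⟨ sym (map-zipWith _,_ _ (v ∷ vs) (vs ∷ʳ v)) ⟩
  map (λ (x , y) → f x , f y) (zip (v ∷ vs) (vs ∷ʳ v)) ∎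
  where open ≡-Reasoning

unique-++ˡ : ∀ (xs : List A) {ys} → Unique (xs ++ ys) → Unique xs
unique-++ˡ []       _        = []
unique-++ˡ (x ∷ xs) (x≢ ∷ u) = Allₚ.++⁻ˡ xs x≢ ∷ unique-++ˡ xs u

∉⇒unique-∷ : {x : A} {xs : List A} → x ∉ xs → Unique xs → Unique (x ∷ xs)
∉⇒unique-∷ x∉ u = Allₚ.¬Any⇒All¬ _ x∉ ∷ u

module _ {E : Rel (Fin n) 0ℓ} where

  -- Once `v` is rotated to the front, its neighbours are the second and the last entry, which
  -- differ because the length is at least 3. Hence no cycle passes through a leaf.
  cycle-neighbours : ∀ {c v} → IsCycle E c → v ∈ c → ∃ λ x → ∃ λ y → x ≢ y × E v x × E y v
  cycle-neighbours (mkIsCycle long distinct adjacent) v∈c with rotate-to v∈c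
  ... | []         , p , _ = contradiction (subst (3 ≤_) (↭-length p) long) λ { (s≤s ()) }
  ... | _ ∷ []     , p , _ = contradiction (subst (3 ≤_) (↭-length p) long) λ { (s≤s (s≤s ())) }
  ... | x ∷ z ∷ zs , p , r with arc-to-last z zs _ | Unique-resp-↭ p distinct | All-resp-↭ r adjacent
  ...   | y , y∈ , a∈ | _ ∷ (x≢ ∷ _) | adj =
    x , y , All.lookup x≢ y∈ , All.lookup adj (here refl) , All.lookup adj (there (there a∈))

  -- Unlike `Star`, the type displays the visited vertices, so that distinctness and membership can
  -- be stated about them.
  data Walk (x : Fin n) : List (Fin n) → Fin n → Set where
    stop : Walk x (x ∷ []) x
    _∷_  : ∀ {z p y} → E x z → Walk z p y → Walk x (x ∷ p) y

  closed-walk : ∀ {x p y v} → Walk x p y → E y v → All (uncurry E) (zip p (drop 1 p ∷ʳ v))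
  closed-walk stop                f = f ∷ []
  closed-walk (e ∷ stop)          f = e ∷ f ∷ []
  closed-walk (e ∷ w@(_ ∷ _))     f = e ∷ closed-walk w f

  walk-arcs : ∀ {x p y v} → Walk x p y → E v x → E y v → All (uncurry E) (arcs (v ∷ p))
  walk-arcs w@stop    e f = e ∷ closed-walk w f
  walk-arcs w@(_ ∷ _) e f = e ∷ closed-walk w f

  -- Cuts a cycle at `v`, keeping one of the two sides between the ends of a chord. The vertex `r`,
  -- where the whole cycle closes, stays fixed while the induction moves along.
  prefix-walk : ∀ {x v r} xs {ys} →
    All (uncurry E) (zip (x ∷ xs ++ v ∷ ys) ((xs ++ v ∷ ys) ∷ʳ r)) → Walk x (x ∷ xs ∷ʳ v) v
  prefix-walk []       (e ∷ _)   = e ∷ stop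
  prefix-walk (z ∷ xs) (e ∷ adj) = e ∷ prefix-walk xs adj

  walk-∈ : {V : Pred (Fin n) 0ℓ} → (∀ a b → E a b → V b) →
           ∀ {x p y} → V x → Walk x p y → All V p
  walk-∈ V-closed vx stop    = vx ∷ []
  walk-∈ V-closed vx (e ∷ w) = vx ∷ walk-∈ V-closed (V-closed _ _ e) w

  walk-length : ∀ {x p y} → x ≢ y → Walk x p y → 2 ≤ length p
  walk-length x≢y stop          = contradiction refl x≢y
  walk-length x≢y (_ ∷ stop)    = s≤s (s≤s z≤n)
  walk-length x≢y (_ ∷ (_ ∷ _)) = s≤s (s≤s z≤n)

  walk-suffix : ∀ {x p y z} → Walk x p y → Unique p → z ∈ p → ∃ λ q → Walk z q y × Unique q
  walk-suffix w@stop    u (here refl) = _ , w , u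
  walk-suffix w@(_ ∷ _) u (here refl) = _ , w , u
  walk-suffix (_ ∷ w) (_ ∷ u) (there z∈) = walk-suffix w u z∈

  -- Loops are removed from the back: if the new first vertex already occurs, the walk restarts at
  -- that occurrence.
  star⇒walk : ∀ {x y} → Star E x y → ∃ λ p → Walk x p y × Unique p
  star⇒walk ε = _ , stop , [] ∷ []
  star⇒walk {x} (e ◅ es) with star⇒walk es
  ... | p , w , u with x ∈? p
  ...   | yes x∈p = walk-suffix w u x∈p
  ...   | no  x∉p = _ , e ∷ w , ∉⇒unique-∷ x∉p u

walk-map : {E F : Rel (Fin n) 0ℓ} → (∀ {a b} → E a b → F a b) →
           ∀ {x p y} → Walk {E = E} x p y → Walk {E = F} x p y
walk-map f stop    = stop
walk-map f (e ∷ w) = f e ∷ walk-map f w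

-- Adding and removing a leaf of a subtree

module _ (v w : Fin n) (H : PreSubgraph n) where

  graftVertex? : U.Decidable (λ u → Vertex H u ⊎ u ≡ v)
  graftVertex? u = vertex? H u ⊎-dec u ≟ v

  graftEdge? : Decidable (λ x y → Edge H x y ⊎ (x ≡ v × y ≡ w) ⊎ (x ≡ w × y ≡ v))
  graftEdge? x y = edge? H x y ⊎-dec ((x ≟ v ×-dec y ≟ w) ⊎-dec (x ≟ w ×-dec y ≟ v))

  graft : PreSubgraph n
  graft = preSubgraph graftVertex? graftEdge?

module _ (v : Fin n) (H : PreSubgraph n) where

  pruneVertex? : U.Decidable (λ u → Vertex H u × u ≢ v)
  pruneVertex? u = vertex? H u ×-dec ¬? (u ≟ v)

  pruneEdge? : Decidable (λ x y → Edge H x y × x ≢ v × y ≢ v)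
  pruneEdge? x y = edge? H x y ×-dec (¬? (x ≟ v) ×-dec ¬? (y ≟ v))

  prune : PreSubgraph n
  prune = preSubgraph pruneVertex? pruneEdge?

prune-graft : {G : Graph n} {H : PreSubgraph n} {v w : Fin n} →
              IsSubgraph G H → ¬ Vertex H v → prune v (graft v w H) ≡ H
prune-graft {H = H} {v} {w} sub v∉H = preSubgraph-ext
  (λ u∈ → let u∈′ , u≢v = vertex⁻ PV? PE? u∈ in
    [ id , (λ u≡v → contradiction u≡v u≢v) ]′ (vertex⁻ GV? GE? u∈′))
  (λ u∈ → vertex⁺ PV? PE? (vertex⁺ GV? GE? (inj₁ u∈) , λ { refl → v∉H u∈ }))
  (λ e → let e′ , x≢v , y≢v = edge⁻ PV? PE? e in
    [ id , [ (λ (x≡v , _) → contradiction x≡v x≢v) , (λ (_ , y≡v) → contradiction y≡v y≢v) ]′ ]′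
      (edge⁻ GV? GE? e′))
  (λ e → edge⁺ PV? PE?
    ( edge⁺ GV? GE? (inj₁ e)
    , (λ { refl → v∉H (edge-vertex _ _ e) })
    , λ { refl → v∉H (edge-vertex _ _ (edge-sym _ _ e)) }))
  where
  open IsSubgraph sub
  GV? = graftVertex? v w H
  GE? = graftEdge? v w H
  PV? = pruneVertex? v (graft v w H)
  PE? = pruneEdge? v (graft v w H)

graft-prune : {G : Graph n} {H : PreSubgraph n} {v w : Fin n} →
              IsSubgraph G H → Edge H v w → (∀ x → Edge H v x → x ≡ w) → graft v w (prune v H) ≡ H
graft-prune {H = H} {v} {w} sub vw only = preSubgraph-ext
  (λ u∈ → [ (λ u∈′ → proj₁ (vertex⁻ PV? PE? u∈′)) , (λ { refl → edge-vertex _ _ vw }) ]′ (vertex⁻ GV? GE? u∈))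
  vertex-back
  (λ e → [ (λ e′ → proj₁ (edge⁻ PV? PE? e′))
         , [ (λ { (refl , refl) → vw }) , (λ { (refl , refl) → edge-sym _ _ vw }) ]′ ]′ (edge⁻ GV? GE? e))
  edge-back
  where
  open IsSubgraph sub
  PV? = pruneVertex? v H
  PE? = pruneEdge? v H
  GV? = graftVertex? v w (prune v H)
  GE? = graftEdge? v w (prune v H)
  vertex-back : ∀ {u} → Vertex H u → Vertex (graft v w (prune v H)) u
  vertex-back {u} u∈ with u ≟ v
  ... | yes u≡v = vertex⁺ GV? GE? (inj₂ u≡v)
  ... | no  u≢v = vertex⁺ GV? GE? (inj₁ (vertex⁺ PV? PE? (u∈ , u≢v)))
  edge-back : ∀ {x y} → Edge H x y → Edge (graft v w (prune v H)) x y
  edge-back {x} {y} e with x ≟ v | y ≟ v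
  ... | yes refl | _        = edge⁺ GV? GE? (inj₂ (inj₁ (refl , only _ e)))
  ... | no  _    | yes refl = edge⁺ GV? GE? (inj₂ (inj₂ (only _ (edge-sym _ _ e) , refl)))
  ... | no  x≢v  | no  y≢v  = edge⁺ GV? GE? (inj₁ (edge⁺ PV? PE? (e , x≢v , y≢v)))

-- All connections are routed through `w`. In the grafted graph `v` has no neighbour but `w`, so a
-- cycle avoids `v` and already lies in `H`.
graft-subtree : {G : Graph n} {H : PreSubgraph n} {v w : Fin n} →
                IsSubtree G H → ¬ Vertex H v → Vertex H w → Adj G v w → IsSubtree G (graft v w H)
graft-subtree {G = G} {H} {v} {w} (mkIsSubtree sub tree) v∉H w∈H vw = mkIsSubtree
  (mkIsSubgraph
    (λ x y e → edge⁺ GV? GE? ([ inj₁ ∘ edge-sym x y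
      , [ (λ (p , q) → inj₂ (inj₂ (q , p))) , (λ (p , q) → inj₂ (inj₁ (q , p))) ]′ ]′ (edge⁻ GV? GE? e)))
    (λ x y e → vertex⁺ GV? GE? ([ inj₁ ∘ edge-vertex x y
      , [ (λ (p , _) → inj₂ p) , (λ { (refl , _) → inj₁ w∈H }) ]′ ]′ (edge⁻ GV? GE? e)))
    (λ x y e → [ edge-adj x y
      , [ (λ { (refl , refl) → vw }) , (λ { (refl , refl) → symm G vw }) ]′ ]′ (edge⁻ GV? GE? e)))
  (mkIsTree (v , vertex⁺ GV? GE? (inj₂ refl))
    (λ x y x∈ y∈ → to-w (vertex⁻ GV? GE? x∈) ◅◅ from-w (vertex⁻ GV? GE? y∈))
    λ (c , isCycle) → acyclic (c , cycle-in-H isCycle))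
  where
  open IsSubgraph sub
  open IsTree tree
  GV? = graftVertex? v w H
  GE? = graftEdge? v w H
  include : ∀ {x y} → Star (Edge H) x y → Star (Edge (graft v w H)) x y
  include = Star.map (λ e → edge⁺ GV? GE? (inj₁ e))
  to-w : ∀ {x} → Vertex H x ⊎ x ≡ v → Star (Edge (graft v w H)) x w
  to-w (inj₁ x∈)   = include (connected _ _ x∈ w∈H)
  to-w (inj₂ refl) = edge⁺ GV? GE? (inj₂ (inj₁ (refl , refl))) ◅ ε
  from-w : ∀ {x} → Vertex H x ⊎ x ≡ v → Star (Edge (graft v w H)) w x
  from-w (inj₁ x∈)   = include (connected _ _ w∈H x∈)
  from-w (inj₂ refl) = edge⁺ GV? GE? (inj₂ (inj₂ (refl , refl))) ◅ ε
  at-v : ∀ {x} → Edge H v x ⊎ (v ≡ v × x ≡ w) ⊎ (v ≡ w × x ≡ v) → x ≡ w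
  at-v (inj₁ e)                    = contradiction (edge-vertex _ _ e) v∉H
  at-v (inj₂ (inj₁ (_ , x≡w)))     = x≡w
  at-v (inj₂ (inj₂ (refl , x≡v))) = x≡v
  to-v : ∀ {x} → Edge H x v ⊎ (x ≡ v × v ≡ w) ⊎ (x ≡ w × v ≡ v) → x ≡ w
  to-v (inj₁ e)                    = contradiction (edge-vertex _ _ (edge-sym _ _ e)) v∉H
  to-v (inj₂ (inj₁ (x≡v , refl))) = x≡v
  to-v (inj₂ (inj₂ (x≡w , _)))     = x≡w
  cycle-in-H : ∀ {c} → IsCycle (Edge (graft v w H)) c → IsCycle (Edge H) c
  cycle-in-H {c} cyc@(mkIsCycle long distinct adjacent) = mkIsCycle long distinct
    (All.tabulate λ {(x , y)} a∈ → avoid-v (arcs-∈ a∈) (edge⁻ GV? GE? (All.lookup adjacent a∈)))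
    where
    v∉c : v ∉ c
    v∉c v∈c with cycle-neighbours cyc v∈c
    ... | x , y , x≢y , e , f = x≢y (trans (at-v (edge⁻ GV? GE? e)) (sym (to-v (edge⁻ GV? GE? f))))
    avoid-v : ∀ {x y} → x ∈ c × y ∈ c → Edge H x y ⊎ (x ≡ v × y ≡ w) ⊎ (x ≡ w × y ≡ v) → Edge H x y
    avoid-v _          (inj₁ e)                   = e
    avoid-v (x∈c , _) (inj₂ (inj₁ (refl , _))) = contradiction x∈c v∉c
    avoid-v (_ , y∈c) (inj₂ (inj₂ (_ , refl))) = contradiction y∈c v∉c

-- Connectivity survives because a walk can enter and leave `v` only through `w`, so each visit to
-- `v` is a detour that can be cut out.
prune-subtree : {G : Graph n} {H : PreSubgraph n} {v w : Fin n} →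
                IsSubtree G H → Edge H v w → (∀ x → Edge H v x → x ≡ w) → IsSubtree G (prune v H)
prune-subtree {G = G} {H} {v} {w} (mkIsSubtree sub tree) vw only = mkIsSubtree
  (mkIsSubgraph
    (λ x y e → let e′ , x≢v , y≢v = edge⁻ PV? PE? e in edge⁺ PV? PE? (edge-sym _ _ e′ , y≢v , x≢v))
    (λ x y e → let e′ , x≢v , _ = edge⁻ PV? PE? e in vertex⁺ PV? PE? (edge-vertex _ _ e′ , x≢v))
    (λ x y e → edge-adj _ _ (proj₁ (edge⁻ PV? PE? e))))
  (mkIsTree (w , vertex⁺ PV? PE? (edge-vertex _ _ (edge-sym _ _ vw) , w≢v))
    (λ x y x∈ y∈ → let x∈′ , x≢v = vertex⁻ PV? PE? x∈ ; y∈′ , y≢v = vertex⁻ PV? PE? y∈ in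
      shortcut y≢v x≢v (connected _ _ x∈′ y∈′))
    λ (c , mkIsCycle long distinct adjacent) →
      acyclic (c , mkIsCycle long distinct (All.map (λ e → proj₁ (edge⁻ PV? PE? e)) adjacent)))
  where
  open IsSubgraph sub
  open IsTree tree
  PV? = pruneVertex? v H
  PE? = pruneEdge? v H
  w≢v : w ≢ v
  w≢v w≡v = irrefl G (sym w≡v) (edge-adj _ _ vw)
  shortcut   : ∀ {x y} → y ≢ v → x ≢ v → Star (Edge H) x y → Star (Edge (prune v H)) x y
  shortcut-v : ∀ {y} → y ≢ v → Star (Edge H) v y → Star (Edge (prune v H)) w y
  shortcut y≢v x≢v ε = ε
  shortcut {x} y≢v x≢v (_◅_ {j = z} e es) with z ≟ v
  ... | no  z≢v  = edge⁺ PV? PE? (e , x≢v , z≢v) ◅ shortcut y≢v z≢v es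
  -- The vertex before `v` must be `w`; the walk resumes at `w` once it has left `v`.
  ... | yes refl rewrite only x (edge-sym _ _ e) = shortcut-v y≢v es
  shortcut-v y≢v ε = contradiction refl y≢v
  shortcut-v y≢v (e ◅ es) with only _ e
  ... | refl = shortcut y≢v w≢v es

single : Fin n → PreSubgraph n
single v = preSubgraph (_≟ v) (λ _ _ → no id)

single-subtree : (G : Graph n) (v : Fin n) → IsSubtree G (single v)
single-subtree G v = mkIsSubtree
  (mkIsSubgraph (λ _ _ → ⊥-elim ∘ no-edge) (λ _ _ → ⊥-elim ∘ no-edge) (λ _ _ → ⊥-elim ∘ no-edge))
  (mkIsTree (v , vertex⁺ (_≟ v) E? refl)
    (λ x y x∈ y∈ → subst₂ (Star _) (sym (vertex⁻ (_≟ v) E? x∈)) (sym (vertex⁻ (_≟ v) E? y∈)) ε)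
    λ { ([] , mkIsCycle () _ _)
      ; (u ∷ us , mkIsCycle _ _ adjacent) →
          no-edge (All.lookup adjacent (proj₂ (arc-from {c = u ∷ us} (here refl)))) })
  where
  E? : Decidable (λ _ _ → ⊥)
  E? _ _ = no id
  no-edge : ∀ {x y} → Edge (single v) x y → ⊥
  no-edge = edge⁻ (_≟ v) E?

-- Leaf recurrences for the number of subtrees inside S containing T

Within : Graph n → List (Fin n) → List (Fin n) → Pred (PreSubgraph n) 0ℓ
Within G S T H = IsSubtree G H × (∀ u → Vertex H u → u ∈ S) × All (Vertex H) T

within? : (G : Graph n) (S T : List (Fin n)) → U.Decidable (Within G S T)
within? G S T H =
  isSubtree? G H ×-dec ((all? λ u → vertex? H u →-dec u ∈? S) ×-dec All.all? (vertex? H) T)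

-- The empty subtree is excluded here, as `IsTree` demands a vertex; `numSubtrees-N` restores it
-- with a `suc`.
N : Graph n → List (Fin n) → List (Fin n) → ℕ
N G S T = count (within? G S T)

-- Serves twice: as a subtree inside `S` containing any prescribed vertices of `S`, and as a supply
-- of walks that stay in `S`.
Spanned : Graph n → List (Fin n) → Set
Spanned {n} G S = Σ (PreSubgraph n) λ H →
  IsSubtree G H × (∀ u → Vertex H u → u ∈ S) × (∀ u → u ∈ S → Vertex H u)

-- The notion is relative to `S`: in `G` the vertex `v` may have further neighbours, to be attached
-- later.
record Leaf (G : Graph n) (S : List (Fin n)) (v w : Fin n) : Set where
  field
    new  : v ∉ S
    old  : w ∈ S
    edge : Adj G v w
    only : ∀ x → x ∈ S → Adj G v x → x ≡ w

module _ {G : Graph n} where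

  N-mono : ∀ {S S′ T T′} → S ⊆ S′ → T′ ⊆ T → N G S T ≤ N G S′ T′
  N-mono S⊆ T⊇ = count-mono (within? G _ _) (within? G _ _) λ H (t , H⊆S , T⊆H) →
    t , (λ u u∈ → S⊆ (H⊆S u u∈)) , All.tabulate (λ u∈ → All.lookup T⊆H (T⊇ u∈))

  N-spanned : ∀ {S T} → Spanned G S → T ⊆ S → 1 ≤ N G S T
  N-spanned (H , t , H⊆S , S⊆H) T⊆S =
    count-inhabited (within? G _ _) (H , t , H⊆S , All.tabulate (λ u∈ → S⊆H _ (T⊆S u∈)))

  spanned-single : ∀ v → Spanned G (v ∷ [])
  spanned-single v = single v , single-subtree G v
    , (λ u u∈ → here (vertex⁻ (_≟ v) (λ _ _ → no id) u∈))
    , λ { u (here u≡v) → vertex⁺ (_≟ v) (λ _ _ → no id) u≡v }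

  spanned-∷ : ∀ {S v w} → v ∉ S → w ∈ S → Adj G v w → Spanned G S → Spanned G (v ∷ S)
  spanned-∷ {S} {v} {w} v∉S w∈S vw (H , t , H⊆S , S⊆H) =
    graft v w H , graft-subtree t (v∉S ∘ H⊆S v) (S⊆H w w∈S) vw
    , (λ u u∈ → [ there ∘ H⊆S u , here ]′ (vertex⁻ GV? GE? u∈))
    , λ { u (here u≡v) → vertex⁺ GV? GE? (inj₂ u≡v) ; u (there u∈) → vertex⁺ GV? GE? (inj₁ (S⊆H u u∈)) }
    where
    GV? = graftVertex? v w H
    GE? = graftEdge? v w H

  N-split : ∀ {S v} T → v ∉ S → N G (v ∷ S) T ≡ N G S T + N G (v ∷ S) (v ∷ T)
  N-split {S} {v} T v∉S = trans (count-split (within? G (v ∷ S) T) (λ H → vertex? H v))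
    (trans (cong₂ _+_
      (≤-antisym
        (count-mono _ (within? G (v ∷ S) (v ∷ T)) λ H ((t , H⊆ , T⊆) , v∈) → t , H⊆ , v∈ ∷ T⊆)
        (count-mono (within? G (v ∷ S) (v ∷ T)) _ λ { H (t , H⊆ , v∈ ∷ T⊆) → (t , H⊆ , T⊆) , v∈ }))
      (≤-antisym
        (count-mono _ (within? G S T) λ H ((t , H⊆ , T⊆) , v∉) →
          t , (λ u u∈ → drop-v H v∉ u∈ (H⊆ u u∈)) , T⊆)
        (count-mono (within? G S T) _ λ H (t , H⊆ , T⊆) →
          (t , (λ u u∈ → there (H⊆ u u∈)) , T⊆) , v∉S ∘ H⊆ v)))
      (+-comm (N G (v ∷ S) (v ∷ T)) (N G S T)))
    where
    drop-v : ∀ H {u} → ¬ Vertex H v → Vertex H u → u ∈ v ∷ S → u ∈ S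
    drop-v H v∉ u∈ (here refl)  = contradiction u∈ v∉
    drop-v H v∉ u∈ (there u∈S) = u∈S

  module _ {S : List (Fin n)} {v w : Fin n} (leaf : Leaf G S v w) where

    open Leaf leaf

    leaf-neighbour : ∀ {H} → IsSubtree G H → (∀ u → Vertex H u → u ∈ v ∷ S) → ∀ x → Edge H v x → x ≡ w
    leaf-neighbour (mkIsSubtree sub _) H⊆ x e with H⊆ x (edge-vertex _ _ (edge-sym _ _ e))
      where open IsSubgraph sub
    ... | here x≡v  = contradiction (IsSubgraph.edge-adj sub _ _ e) (irrefl G (sym x≡v))
    ... | there x∈S = only x x∈S (IsSubgraph.edge-adj sub _ _ e)

    -- A walk in `H` from `v` to `u` has a first edge, and that edge can only lead to `w`.
    leaf-edge : ∀ {H u} → IsSubtree G H → (∀ u → Vertex H u → u ∈ v ∷ S) →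
                Vertex H v → Vertex H u → u ≢ v → Edge H v w
    leaf-edge {H} t H⊆ v∈ u∈ u≢v with IsTree.connected (IsSubtree.isTree t) _ _ v∈ u∈
    ... | ε     = contradiction refl u≢v
    ... | e ◅ _ = subst (Edge H v) (leaf-neighbour t H⊆ _ e) e

    private
      u∈S⇒u≢v : ∀ {u} → u ∈ S → u ≢ v
      u∈S⇒u≢v u∈S refl = new u∈S

    -- Pruning `v` is injective, since grafting it back at `w` recovers the subtree. A subtree
    -- containing `u` but not `w` is never reached, hence only an inequality.
    N-leaf-≤ : ∀ {u} → u ∈ S → N G (v ∷ S) (v ∷ u ∷ []) ≤ N G S (u ∷ [])
    N-leaf-≤ {u} u∈S = count-≤ (within? G (v ∷ S) (v ∷ u ∷ [])) (within? G S (u ∷ [])) (prune v) (graft v w)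
      (λ { H (t , H⊆ , v∈ ∷ u∈ ∷ []) →
        prune-subtree t (leaf-edge t H⊆ v∈ u∈ (u∈S⇒u≢v u∈S)) (leaf-neighbour t H⊆)
        , (λ x x∈ → pruned H H⊆ x (vertex⁻ (pruneVertex? v H) (pruneEdge? v H) x∈))
        , vertex⁺ (pruneVertex? v H) (pruneEdge? v H) (u∈ , u∈S⇒u≢v u∈S) ∷ [] })
      (λ { H (t , H⊆ , v∈ ∷ u∈ ∷ []) →
        graft-prune (IsSubtree.isSubgraph t) (leaf-edge t H⊆ v∈ u∈ (u∈S⇒u≢v u∈S)) (leaf-neighbour t H⊆) })
      where
      pruned : ∀ H → (∀ u → Vertex H u → u ∈ v ∷ S) → ∀ x → Vertex H x × x ≢ v → x ∈ S
      pruned H H⊆ x (x∈ , x≢v) with H⊆ x x∈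
      ... | here x≡v  = contradiction x≡v x≢v
      ... | there x∈S = x∈S

    N-leaf-≥ : N G S (w ∷ []) ≤ N G (v ∷ S) (v ∷ w ∷ [])
    N-leaf-≥ = count-≤ (within? G S (w ∷ [])) (within? G (v ∷ S) (v ∷ w ∷ [])) (graft v w) (prune v)
      (λ { H (t , H⊆ , w∈ ∷ []) →
        graft-subtree t (new ∘ H⊆ v) w∈ edge
        , (λ x x∈ → [ there ∘ H⊆ x , here ]′ (vertex⁻ (graftVertex? v w H) (graftEdge? v w H) x∈))
        , vertex⁺ (graftVertex? v w H) (graftEdge? v w H) (inj₂ refl)
          ∷ vertex⁺ (graftVertex? v w H) (graftEdge? v w H) (inj₁ w∈) ∷ [] })
      (λ { H (t , H⊆ , _) → prune-graft (IsSubtree.isSubgraph t) (new ∘ H⊆ v) })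

    N-leaf-= : N G (v ∷ S) (v ∷ w ∷ []) ≡ N G S (w ∷ [])
    N-leaf-= = ≤-antisym (N-leaf-≤ old) N-leaf-≥

    -- The subtrees through `v` that contain `w` correspond to those of `S` at `w`; the one left
    -- over is the vertex `v` alone, which gives the `suc`.
    N-leaf : N G (v ∷ S) (v ∷ []) ≡ suc (N G S (w ∷ []))
    N-leaf = trans (count-split (within? G (v ∷ S) (v ∷ [])) (λ H → vertex? H w))
      (trans (cong₂ _+_ (trans with-w N-leaf-=) without-w) (+-comm (N G S (w ∷ [])) 1))
      where
      with-w : count (λ H → within? G (v ∷ S) (v ∷ []) H ×-dec vertex? H w) ≡ N G (v ∷ S) (v ∷ w ∷ [])
      with-w = ≤-antisym
        (count-mono _ (within? G (v ∷ S) (v ∷ w ∷ []))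
          λ { H ((t , H⊆ , v∈ ∷ []) , w∈) → t , H⊆ , v∈ ∷ w∈ ∷ [] })
        (count-mono (within? G (v ∷ S) (v ∷ w ∷ [])) _
          λ { H (t , H⊆ , v∈ ∷ w∈ ∷ []) → (t , H⊆ , v∈ ∷ []) , w∈ })
      E? : Decidable (λ _ _ → ⊥)
      E? _ _ = no id
      is-single : ∀ H → Within G (v ∷ S) (v ∷ []) H × ¬ Vertex H w → H ≡ single v
      is-single H ((t , H⊆ , v∈ ∷ []) , w∉) = preSubgraph-ext
        (λ u∈ → vertex⁺ (_≟ v) E? (only-v u∈))
        (λ u∈ → subst (Vertex H) (sym (vertex⁻ (_≟ v) E? u∈)) v∈)
        (λ e → contradiction (edge-adj _ _ e)
          (irrefl G (trans (only-v (edge-vertex _ _ e)) (sym (only-v (edge-vertex _ _ (edge-sym _ _ e)))))))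
        (λ e → ⊥-elim (edge⁻ (_≟ v) E? e))
        where
        open IsSubgraph (IsSubtree.isSubgraph t)
        only-v : ∀ {u} → Vertex H u → u ≡ v
        only-v {u} u∈ with u ≟ v
        ... | yes u≡v = u≡v
        ... | no  u≢v = contradiction (edge-vertex _ _ (edge-sym _ _ (leaf-edge t H⊆ v∈ u∈ u≢v))) w∉
      without-w : count (λ H → within? G (v ∷ S) (v ∷ []) H ×-dec ¬? (vertex? H w)) ≡ 1
      without-w = ≤-antisym (count-≤1 _ (single v) is-single)
        (count-inhabited _ (single v ,
          ( single-subtree G v
          , (λ u u∈ → here (vertex⁻ (_≟ v) E? u∈))
          , vertex⁺ (_≟ v) E? refl ∷ [])
          , λ w∈ → irrefl G (sym (vertex⁻ (_≟ v) E? w∈)) edge))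

-- Growing a vertex set leaf by leaf

data Grown (G : Graph n) (c : List (Fin n)) : ℕ → List (Fin n) → Set where
  base   : Grown G c 0 c
  attach : ∀ {S v w} → Grown G c k S → Leaf G S v w → Grown G c (suc k) (v ∷ S)

-- The recurrence `N-total` with the least possible rooted count `k + t` at the point of attachment;
-- `b` and `t` stand for the total and the rooted count of the cycle.
lowerTotal : (b t k : ℕ) → ℕ
lowerTotal b t zero    = b
lowerTotal b t (suc k) = lowerTotal b t k + suc (k + t)

-- The same recurrence with the greatest possible rooted count.
upperTotal : (b t k : ℕ) → ℕ
upperTotal b t zero    = b
upperTotal b t (suc k) = upperTotal b t k + suc (2 ^ k * t)

2^1+k : ∀ k t → 2 ^ suc k * t ≡ 2 ^ k * t + 2 ^ k * t
2^1+k k t = trans (cong (_* t) (cong (2 ^ k +_) (+-identityʳ (2 ^ k)))) (*-distribʳ-+ t (2 ^ k) (2 ^ k))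

numSubtrees-N : (G : Graph n) {S : List (Fin n)} → (∀ u → u ∈ S) → numSubtrees G ≡ suc (N G S [])
numSubtrees-N G all∈S = cong suc (≤-antisym
  (count-mono (isSubtree? G) (within? G _ _) λ H t → t , (λ u _ → all∈S u) , [])
  (count-mono (within? G _ _) (isSubtree? G) λ H → proj₁))

N-total : {G : Graph n} {S : List (Fin n)} {v w : Fin n} → Leaf G S v w →
          N G (v ∷ S) [] ≡ N G S [] + suc (N G S (w ∷ []))
N-total {G = G} {S} leaf = trans (N-split [] (Leaf.new leaf)) (cong (N G S [] +_) (N-leaf leaf))

module _ {G : Graph n} {c : List (Fin n)} where

  grown-spanned : ∀ {S} → Grown G c k S → Spanned G c → Spanned G S
  grown-spanned base            sp = sp
  grown-spanned (attach g leaf) sp = spanned-∷ new old edge (grown-spanned g sp)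
    where open Leaf leaf

  grown-length : ∀ {S} → Grown G c k S → length S ≡ k + length c
  grown-length base         = refl
  grown-length (attach g _) = cong suc (grown-length g)

  grown-unique : ∀ {S} → Grown G c k S → Unique c → Unique S
  grown-unique base            u = u
  grown-unique (attach g leaf) u = ∉⇒unique-∷ (Leaf.new leaf) (grown-unique g u)

  grown-⊇ : ∀ {S} → Grown G c k S → c ⊆ S
  grown-⊇ base         x∈ = x∈
  grown-⊇ (attach g _) x∈ = there (grown-⊇ g x∈)

  module _ {t : ℕ} (sp : Spanned G c) (rooted : ∀ u → u ∈ c → N G c (u ∷ []) ≡ t) where

    rooted-lower : ∀ {S u} → Grown G c k S → u ∈ S → k + t ≤ N G S (u ∷ [])
    rooted-lower base u∈ = ≤-reflexive (sym (rooted _ u∈))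
    -- At the new leaf itself the count exceeds that of its neighbour by exactly one.
    rooted-lower (attach g leaf) (here refl) =
      subst (_ ≤_) (sym (N-leaf leaf)) (s≤s (rooted-lower g (Leaf.old leaf)))
    rooted-lower {suc k} {v ∷ S} {u} g′@(attach g leaf) (there u∈) = begin
      suc (k + t)                                ≡⟨ +-comm 1 (k + t) ⟩
      k + t + 1                                  ≤⟨ +-mono-≤ (rooted-lower g u∈)
                                                      (N-spanned (grown-spanned g′ sp) λ
                                                        { (here e) → here e ; (there (here refl)) → there u∈ }) ⟩
      N G S (u ∷ []) + N G (v ∷ S) (v ∷ u ∷ [])  ≡⟨ sym (N-split (u ∷ []) (Leaf.new leaf)) ⟩
      N G (v ∷ S) (u ∷ [])                       ∎
      where open ≤-Reasoning

    rooted-upper : ∀ {S u} → Grown G c k S → u ∈ S → N G S (u ∷ []) ≤ 2 ^ k * t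
    rooted-upper base u∈ = ≤-reflexive (trans (rooted _ u∈) (sym (+-identityʳ t)))
    rooted-upper {suc k} {v ∷ S} (attach {w = w} g leaf) (here refl) = begin
      N G (v ∷ S) (v ∷ [])               ≡⟨ N-leaf leaf ⟩
      -- The single-vertex subtree is absorbed into a second copy of the count at `w`, so the
      -- doubling bound also covers the new leaf.
      1 + N G S (w ∷ [])                 ≤⟨ +-monoˡ-≤ _ (N-spanned (grown-spanned g sp)
                                              λ { (here refl) → Leaf.old leaf }) ⟩
      N G S (w ∷ []) + N G S (w ∷ [])    ≤⟨ +-mono-≤ (rooted-upper g (Leaf.old leaf)) (rooted-upper g (Leaf.old leaf)) ⟩
      2 ^ k * t + 2 ^ k * t              ≡⟨ sym (2^1+k k t) ⟩
      2 ^ suc k * t                      ∎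
      where open ≤-Reasoning
    rooted-upper {suc k} {v ∷ S} {u} (attach g leaf) (there u∈) = begin
      N G (v ∷ S) (u ∷ [])                       ≡⟨ N-split (u ∷ []) (Leaf.new leaf) ⟩
      N G S (u ∷ []) + N G (v ∷ S) (v ∷ u ∷ [])  ≤⟨ +-monoʳ-≤ _ (N-leaf-≤ leaf u∈) ⟩
      N G S (u ∷ []) + N G S (u ∷ [])            ≤⟨ +-mono-≤ (rooted-upper g u∈) (rooted-upper g u∈) ⟩
      2 ^ k * t + 2 ^ k * t                      ≡⟨ sym (2^1+k k t) ⟩
      2 ^ suc k * t                              ∎
      where open ≤-Reasoning

    total-lower : ∀ {S} → Grown G c k S → lowerTotal (N G c []) t k ≤ N G S []
    total-lower base            = ≤-refl
    total-lower (attach g leaf) = subst (_ ≤_) (sym (N-total leaf))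
      (+-mono-≤ (total-lower g) (s≤s (rooted-lower g (Leaf.old leaf))))

    total-upper : ∀ {S} → Grown G c k S → N G S [] ≤ upperTotal (N G c []) t k
    total-upper base            = ≤-refl
    total-upper (attach g leaf) = subst (_≤ _) (sym (N-total leaf))
      (+-mono-≤ (total-upper g) (s≤s (rooted-upper g (Leaf.old leaf))))

-- Induced cycles of equal length are isomorphic

-- Absence of chords makes the subgraphs of `G` inside `c` those of the bare cycle.
record Induced (G : Graph n) (c : List (Fin n)) : Set where
  field
    distinct : Unique c
    arc⇒adj  : ∀ {x y} → (x , y) ∈ arcs c → Adj G x y
    adj⇒arc  : ∀ {x y} → x ∈ c → y ∈ c → Adj G x y → CycleEdge c x y

-- Dropping the closing arc leaves a spanning path, built by grafting from the last vertex
-- backwards; `u ∈ c` rules out the empty list.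
induced-spanned : {G : Graph n} {c : List (Fin n)} {u : Fin n} → Induced G c → u ∈ c → Spanned G c
induced-spanned {G = G} {x ∷ xs} ind _ = go x xs distinct (All.tabulate (λ {(y , z)} → arc⇒adj {y} {z}))
  where
  open Induced ind
  go : ∀ y ys {r} → Unique (y ∷ ys) → All (uncurry (Adj G)) (zip (y ∷ ys) (ys ∷ʳ r)) → Spanned G (y ∷ ys)
  go y []       _         _         = spanned-single y
  go y (z ∷ zs) u@(_ ∷ u′) (e ∷ adj) =
    spanned-∷ (Unique[x∷xs]⇒x∉xs u) (here refl) e (go z zs u′ adj)

induced-rotate : {G : Graph n} {c d : List (Fin n)} → c ↭ d → arcs c ↭ arcs d → Induced G c → Induced G d
induced-rotate p r ind = record
  { distinct = Unique-resp-↭ p distinct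
  ; arc⇒adj  = λ a∈ → arc⇒adj (∈-resp-↭ (↭-sym r) a∈)
  ; adj⇒arc  = λ x∈ y∈ e → Sum.map (∈-resp-↭ r) (∈-resp-↭ r)
                 (adj⇒arc (∈-resp-↭ (↭-sym p) x∈) (∈-resp-↭ (↭-sym p) y∈) e)
  }
  where open Induced ind

-- The maps are total on `Fin n` but mutually inverse only between the two lists, so no permutation
-- of all vertices has to be built.
record Embedding (G G′ : Graph n) (c c′ : List (Fin n)) : Set where
  field
    f g : Fin n → Fin n
    f-∈ : ∀ {x} → x ∈ c → f x ∈ c′
    g-∈ : ∀ {y} → y ∈ c′ → g y ∈ c
    g∘f : ∀ {x} → x ∈ c → g (f x) ≡ x
    f∘g : ∀ {y} → y ∈ c′ → f (g y) ≡ y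
    adj : ∀ {x y} → x ∈ c → y ∈ c → Adj G x y → Adj G′ (f x) (f y)

module _ (g : Fin n → Fin n) (S : List (Fin n)) (H : PreSubgraph n) where

  pullVertex? : U.Decidable (λ y → y ∈ S × Vertex H (g y))
  pullVertex? y = y ∈? S ×-dec vertex? H (g y)

  pullEdge? : Decidable (λ x y → (x ∈ S × y ∈ S) × Edge H (g x) (g y))
  pullEdge? x y = (x ∈? S ×-dec y ∈? S) ×-dec edge? H (g x) (g y)

  -- Transport along the inverse map, so that membership is decided pointwise; the test for `S` is
  -- there because `g` is unconstrained elsewhere.
  pull : PreSubgraph n
  pull = preSubgraph pullVertex? pullEdge?

module _ {G G′ : Graph n} {c c′ : List (Fin n)} (emb : Embedding G G′ c c′) where

  open Embedding emb

  -- Walks are pushed forward along `f`, while a cycle in the image is carried back along `g`.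
  pull-subtree : ∀ {H} → IsSubtree G H → (∀ u → Vertex H u → u ∈ c) → IsSubtree G′ (pull g c′ H)
  pull-subtree {H} (mkIsSubtree sub tree) H⊆c = mkIsSubtree
    (mkIsSubgraph
      (λ x y e → let (x∈ , y∈) , e′ = edge⁻ V? E? e in edge⁺ V? E? ((y∈ , x∈) , edge-sym _ _ e′))
      (λ x y e → let (x∈ , y∈) , e′ = edge⁻ V? E? e in vertex⁺ V? E? (x∈ , edge-vertex _ _ e′))
      (λ x y e → let (x∈ , y∈) , e′ = edge⁻ V? E? e in
        subst₂ (Adj G′) (f∘g x∈) (f∘g y∈) (adj (g-∈ x∈) (g-∈ y∈) (edge-adj _ _ e′))))
    (mkIsTree
      (let x , x∈H = nonempty in f x , image x∈H)
      (λ x y x∈ y∈ → let x∈c′ , gx∈ = vertex⁻ V? E? x∈ ; y∈c′ , gy∈ = vertex⁻ V? E? y∈ in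
        subst₂ (Star _) (f∘g x∈c′) (f∘g y∈c′) (push (connected _ _ gx∈ gy∈)))
      λ (d , cyc) → acyclic (map g d , cycle-image cyc))
    where
    open IsSubgraph sub
    open IsTree tree
    V? = pullVertex? g c′ H
    E? = pullEdge? g c′ H
    image : ∀ {x} → Vertex H x → Vertex (pull g c′ H) (f x)
    image x∈ = vertex⁺ V? E? (f-∈ (H⊆c _ x∈) , subst (Vertex H) (sym (g∘f (H⊆c _ x∈))) x∈)
    push-edge : ∀ {x y} → Edge H x y → Edge (pull g c′ H) (f x) (f y)
    push-edge e = edge⁺ V? E?
      ((f-∈ x∈ , f-∈ y∈) , subst₂ (Edge H) (sym (g∘f x∈)) (sym (g∘f y∈)) e)
      where
      x∈ = H⊆c _ (edge-vertex _ _ e)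
      y∈ = H⊆c _ (edge-vertex _ _ (edge-sym _ _ e))
    push : ∀ {x y} → Star (Edge H) x y → Star (Edge (pull g c′ H)) (f x) (f y)
    push = Star.gmap f push-edge
    cycle-image : ∀ {d} → IsCycle (Edge (pull g c′ H)) d → IsCycle (Edge H) (map g d)
    cycle-image {d} (mkIsCycle long distinct adjacent) = mkIsCycle
      (subst (3 ≤_) (sym (length-map g d)) long)
      (map-unique g (λ x∈ y∈ gx≡gy → trans (sym (f∘g (d⊆c′ x∈))) (trans (cong f gx≡gy) (f∘g (d⊆c′ y∈)))) distinct)
      (subst (All _) (sym (arcs-map g d)) (Allₚ.map⁺ (All.map (λ e → proj₂ (edge⁻ V? E? e)) adjacent)))
      where
      d⊆c′ : d ⊆ c′
      -- Injectivity of `g` is known only on `c′`; every vertex of `d` starts an arc of `d`, and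
      -- edges of the image have their ends in `c′`.
      d⊆c′ x∈ = proj₁ (proj₁ (edge⁻ V? E? (All.lookup adjacent (proj₂ (arc-from x∈)))))

  pull-pull : ∀ {H} → IsSubgraph G H → (∀ u → Vertex H u → u ∈ c) → pull f c (pull g c′ H) ≡ H
  pull-pull {H} sub H⊆c = preSubgraph-ext
    (λ u∈ → let u∈c , u∈′ = vertex⁻ V? E? u∈ in subst (Vertex H) (g∘f u∈c) (proj₂ (vertex⁻ V′? E′? u∈′)))
    (λ u∈ → let u∈c = H⊆c _ u∈ in
      vertex⁺ V? E? (u∈c , vertex⁺ V′? E′? (f-∈ u∈c , subst (Vertex H) (sym (g∘f u∈c)) u∈)))
    (λ e → let (x∈ , y∈) , e′ = edge⁻ V? E? e in
      subst₂ (Edge H) (g∘f x∈) (g∘f y∈) (proj₂ (edge⁻ V′? E′? e′)))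
    (λ e → let x∈ = H⊆c _ (edge-vertex _ _ e) ; y∈ = H⊆c _ (edge-vertex _ _ (edge-sym _ _ e)) in
      edge⁺ V? E? ((x∈ , y∈) , edge⁺ V′? E′?
        ((f-∈ x∈ , f-∈ y∈) , subst₂ (Edge H) (sym (g∘f x∈)) (sym (g∘f y∈)) e)))
    where
    open IsSubgraph sub
    V′? = pullVertex? g c′ H
    E′? = pullEdge? g c′ H
    V? = pullVertex? f c (pull g c′ H)
    E? = pullEdge? f c (pull g c′ H)

  N-embedding : ∀ T → N G c T ≤ N G′ c′ (map f T)
  N-embedding T = count-≤ (within? G c T) (within? G′ c′ (map f T)) (pull g c′) (pull f c)
    (λ H (t , H⊆c , T⊆H) →
      pull-subtree t H⊆c
      , (λ u u∈ → proj₁ (vertex⁻ (pullVertex? g c′ H) (pullEdge? g c′ H) u∈))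
      , Allₚ.map⁺ (All.map (λ u∈ → vertex⁺ (pullVertex? g c′ H) (pullEdge? g c′ H)
          (f-∈ (H⊆c _ u∈) , subst (Vertex H) (sym (g∘f (H⊆c _ u∈))) u∈)) T⊆H))
    (λ H (t , H⊆c , _) → pull-pull (IsSubtree.isSubgraph t) H⊆c)

-- Outside the listed keys the value is a mere default.
assoc : List (Fin n × Fin n) → Fin n → Fin n
assoc []            x = x
assoc ((a , b) ∷ p) x = if does (x ≟ a) then b else assoc p x

assoc-∈ : ∀ {p : List (Fin n × Fin n)} {a b} → Unique (map proj₁ p) → (a , b) ∈ p → assoc p a ≡ b
assoc-∈ {a = a} u (here refl) rewrite dec-true (a ≟ a) refl = refl
assoc-∈ {p = (a′ , _) ∷ p} {a} (a′≢ ∷ u) (there ab∈)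
  rewrite dec-false (a ≟ a′) (≢-sym (All.lookup a′≢ (∈-map⁺ proj₁ ab∈))) = assoc-∈ u ab∈

-- Makes both lists projections of one list of pairs, so that the isomorphism matches positions.
pair-up : (xs ys : List A) → length xs ≡ length ys →
          ∃ λ p → map proj₁ p ≡ xs × map {B = A} proj₂ p ≡ ys
pair-up []       []       _ = [] , refl , refl
pair-up (x ∷ xs) (y ∷ ys) e with pair-up xs ys (suc-injective e)
... | p , refl , refl = (x , y) ∷ p , refl , refl

-- The arcs of `p` project to the arcs of both cycles, so corresponding arcs sit at the same place.
embedding : {G G′ : Graph n} (p : List (Fin n × Fin n)) →
            Induced G (map proj₁ p) → Induced G′ (map proj₂ p) →
            Embedding G G′ (map proj₁ p) (map proj₂ p)
embedding {G = G} {G′} p ind ind′ = record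
  { f   = assoc p
  ; g   = assoc (map swap p)
  ; f-∈ = λ x∈ → let ab , ab∈ , e = ∈-map⁻ proj₁ x∈ in
      subst (_∈ map proj₂ p) (sym (trans (cong (assoc p) e) (fwd ab∈))) (∈-map⁺ proj₂ ab∈)
  ; g-∈ = λ y∈ → let ab , ab∈ , e = ∈-map⁻ proj₂ y∈ in
      subst (_∈ map proj₁ p) (sym (trans (cong (assoc (map swap p)) e) (bwd ab∈))) (∈-map⁺ proj₁ ab∈)
  ; g∘f = λ x∈ → let ab , ab∈ , e = ∈-map⁻ proj₁ x∈ in
      trans (cong (assoc (map swap p)) (trans (cong (assoc p) e) (fwd ab∈))) (trans (bwd ab∈) (sym e))
  ; f∘g = λ y∈ → let ab , ab∈ , e = ∈-map⁻ proj₂ y∈ in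
      trans (cong (assoc p) (trans (cong (assoc (map swap p)) e) (bwd ab∈))) (trans (fwd ab∈) (sym e))
  ; adj = λ x∈ y∈ e → [ arc-image , (λ a∈ → symm G′ (arc-image a∈)) ]′ (I.adj⇒arc x∈ y∈ e)
  }
  where
  module I  = Induced ind
  module I′ = Induced ind′
  fwd : ∀ {ab} → ab ∈ p → assoc p (proj₁ ab) ≡ proj₂ ab
  fwd = assoc-∈ I.distinct
  bwd : ∀ {ab} → ab ∈ p → assoc (map swap p) (proj₂ ab) ≡ proj₁ ab
  bwd ab∈ = assoc-∈ (subst Unique (map-∘ p) I′.distinct) (∈-map⁺ swap ab∈)
  arc-image : ∀ {x y} → (x , y) ∈ arcs (map proj₁ p) → Adj G′ (assoc p x) (assoc p y)
  arc-image {x} {y} a∈ with ∈-map⁻ _ (subst ((x , y) ∈_) (arcs-map proj₁ p) a∈)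
  ... | (ab , cd) , q∈ , refl = subst₂ (Adj G′) (sym (fwd ab∈)) (sym (fwd cd∈))
        (I′.arc⇒adj (subst ((proj₂ ab , proj₂ cd) ∈_) (sym (arcs-map proj₂ p)) (∈-map⁺ _ q∈)))
    where
    ab∈ = proj₁ (arcs-∈ {c = p} q∈)
    cd∈ = proj₂ (arcs-∈ {c = p} q∈)

module _ {G G′ : Graph n} {c c′ : List (Fin n)} (ind : Induced G c) (ind′ : Induced G′ c′)
         (len : length c ≡ length c′) where

  N-induced-total : N G c [] ≤ N G′ c′ []
  N-induced-total with pair-up c c′ len
  ... | p , refl , refl = N-embedding (embedding p ind ind′) []

  -- Rotating both cycles so that they start at x and x′ makes the embedding send x to x′.
  N-induced-rooted : ∀ {x x′} → x ∈ c → x′ ∈ c′ → N G c (x ∷ []) ≤ N G′ c′ (x′ ∷ [])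
  N-induced-rooted {x} {x′} x∈ x′∈ with rotate-to x∈ | rotate-to x′∈
  ... | xs , p , r | xs′ , p′ , r′
    with pair-up xs xs′ (suc-injective (trans (sym (↭-length p)) (trans len (↭-length p′))))
  ... | q , refl , refl = begin
    N G c (x ∷ [])                                ≤⟨ N-mono {G = G} (∈-resp-↭ p) id ⟩
    N G (x ∷ map proj₁ q) (x ∷ [])                ≤⟨ N-embedding emb (x ∷ []) ⟩
    N G′ (x′ ∷ map proj₂ q) (assoc q′ x ∷ [])     ≡⟨ cong (λ y → N G′ (x′ ∷ map proj₂ q) (y ∷ []))
                                                       (assoc-∈ {p = q′} (Induced.distinct ind₁) (here refl)) ⟩
    N G′ (x′ ∷ map proj₂ q) (x′ ∷ [])             ≤⟨ N-mono {G = G′} (∈-resp-↭ (↭-sym p′)) id ⟩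
    N G′ c′ (x′ ∷ [])                             ∎
    where
    open ≤-Reasoning
    q′ = (x , x′) ∷ q
    ind₁ = induced-rotate p r ind
    emb = embedding {G = G} {G′} q′ ind₁ (induced-rotate p′ r′ ind′)

-- Unicyclic graphs

module _ {G : Graph n} (U : Unicyclic G) where

  open Unicyclic U
  open IsCycle isCycle

  unicyclic-induced : Induced G cycle
  unicyclic-induced = record
    { distinct = distinct
    ; arc⇒adj  = All.lookup adjacent
    ; adj⇒arc  = chordless
    }
    where
    -- A chord closes up with one of the two arcs of the cycle to another cycle.
    chordless : ∀ {x y} → x ∈ cycle → y ∈ cycle → Adj G x y → CycleEdge cycle x y
    chordless {x} {y} x∈ y∈ xy with rotate-to x∈
    ... | xs , p , r with ∈-resp-↭ p y∈ | All-resp-↭ r adjacent | Unique-resp-↭ p distinct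
    ... | here refl  | _   | _ = contradiction xy (irrefl G refl)
    ... | there y∈xs | adj | u with ∈-∃++ y∈xs
    -- Here `y` directly follows `x`, so the edge is already an arc.
    ... | []     , ys , refl = inj₁ (∈-resp-↭ (↭-sym r) (here refl))
    ... | z ∷ zs , ys , refl with prefix-walk (z ∷ zs) adj
    -- The side from `x` to `y`, closed by the edge `y x`, is a cycle `d`; by uniqueness its closing
    -- arc is an edge of the given cycle.
    ... | e ∷ w = Equivalence.to (unique d d-isCycle x y)
          (inj₂ (there (subst ((y , x) ∈_) (sym (zip-∷ʳ z zs y x)) (∈-++⁺ʳ (zip (z ∷ zs) (zs ∷ʳ y)) (here refl)))))
      where
      d = x ∷ z ∷ zs ∷ʳ y
      d-isCycle : IsCycle (Adj G) d
      d-isCycle = mkIsCycle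
        (s≤s (s≤s (subst (1 ≤_) (sym (length-++-sucʳ zs y [])) (s≤s z≤n))))
        (unique-++ˡ d (subst Unique (sym (++-assoc (x ∷ z ∷ zs) (y ∷ []) ys)) u))
        (walk-arcs w e (symm G xy))

  -- A walk that leaves `S` has a first edge crossing out of it.
  boundary : ∀ {S x y} → Star (Adj G) x y → x ∈ S → y ∉ S → ∃ λ v → ∃ λ w → v ∉ S × w ∈ S × Adj G v w
  boundary ε x∈ y∉ = contradiction x∈ y∉
  boundary {S} {x} (_◅_ {j = z} e es) x∈ y∉ with z ∈? S
  ... | yes z∈ = boundary es z∈ y∉
  ... | no  z∉ = z , x , z∉ , x∈ , symm G e

  -- Two neighbours of v in S would give a cycle through v, but the only cycle lies in S.
  boundary-leaf : ∀ {S v w} → Spanned G S → cycle ⊆ S → v ∉ S → w ∈ S → Adj G v w → Leaf G S v w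
  boundary-leaf {S} {v} {w} (H , mkIsSubtree sub tree , H⊆S , S⊆H) c⊆S v∉S w∈S vw = record
    { new = v∉S ; old = w∈S ; edge = vw ; only = only }
    where
    open IsSubgraph sub
    open IsTree tree using () renaming (connected to H-connected)
    only : ∀ x → x ∈ S → Adj G v x → x ≡ w
    only x x∈S vx with x ≟ w
    ... | yes x≡w = x≡w
    ... | no  x≢w with star⇒walk (H-connected x w (S⊆H x x∈S) (S⊆H w w∈S))
    ...   | p , walk , u = contradiction (c⊆S v∈cycle) v∉S
      where
      p⊆S : All (_∈ S) p
      p⊆S = walk-∈ (λ a b e → H⊆S b (edge-vertex _ _ (edge-sym _ _ e))) x∈S walk
      v∷p-isCycle : IsCycle (Adj G) (v ∷ p)
      v∷p-isCycle = mkIsCycle (s≤s (walk-length x≢w walk))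
        (∉⇒unique-∷ (λ v∈p → v∉S (All.lookup p⊆S v∈p)) u)
        (walk-arcs (walk-map (edge-adj _ _) walk) vx (symm G vw))
      v∈cycle : v ∈ cycle
      v∈cycle with arc-from {c = v ∷ p} (here refl)
      ... | y , a∈ = [ proj₁ ∘ arcs-∈ , proj₂ ∘ arcs-∈ ]′
        (Equivalence.to (unique (v ∷ p) v∷p-isCycle v y) (inj₁ a∈))

  grow : ∀ {u} → u ∈ cycle → Spanned G cycle → ∀ k → k + length cycle ≤ n → ∃ λ S → Grown G cycle k S
  grow u∈ sp zero    _   = cycle , base
  grow {u} u∈ sp (suc k) k<n with grow u∈ sp k (<⇒≤ k<n)
  ... | S , g with all? (_∈? S)
  -- If `S` held every vertex it would have at least `n` entries, but it has `k + length cycle`,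
  -- which is smaller.
  ...   | yes all∈S = contradiction (<-≤-trans k<n (begin
            n                     ≡⟨ sym (length-tabulate id) ⟩
            length (allFin n)     ≤⟨ unique-⊆-length (allFin⁺ n) (λ {x} _ → all∈S x) ⟩
            length S              ≡⟨ grown-length g ⟩
            k + length cycle      ∎)) (<-irrefl refl)
    where open ≤-Reasoning
  ...   | no ¬all∈S with ¬∀⟶∃¬ n (_∈ S) (_∈? S) ¬all∈S
  ...     | x , x∉S with boundary (connected u x _ _) (grown-⊇ g u∈) x∉S
  ...       | v , w , v∉S , w∈S , vw =
    v ∷ S , attach g (boundary-leaf (grown-spanned g sp) (grown-⊇ g) v∉S w∈S vw)

grown-complete : {G : Graph n} {c S : List (Fin n)} → Grown G c k S → Unique c → k + length c ≡ n → ∀ u → u ∈ S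
grown-complete {n} {k} {c = c} {S} g uc k+l≡n u with u ∈? S
... | yes u∈S = u∈S
... | no  u∉S = contradiction (begin
  suc n                  ≡⟨ cong suc (sym k+l≡n) ⟩
  suc (k + length c)     ≡⟨ cong suc (sym (grown-length g)) ⟩
  length (u ∷ S)         ≤⟨ unique-⊆-length (∉⇒unique-∷ u∉S (grown-unique g uc)) (λ {x} _ → ∈-allFin x) ⟩
  length (allFin n)      ≡⟨ length-tabulate id ⟩
  n                      ∎) (<-irrefl refl)
  where open ≤-Reasoning

-- The extremal graphs

-- Listed in decreasing order, so that passing from `m` to `suc m` is a cons, just as in the leaf
-- recurrences.
below : ∀ m → m ≤ n → List (Fin n)
below zero    _   = []
below (suc m) m<n = fromℕ< m<n ∷ below m (<⇒≤ m<n)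

below-length : ∀ m (m≤n : m ≤ n) → length (below m m≤n) ≡ m
below-length zero    _   = refl
below-length (suc m) m<n = cong suc (below-length m (<⇒≤ m<n))

below-∈⁻ : ∀ m {m≤n : m ≤ n} {u} → u ∈ below m m≤n → toℕ u < m
below-∈⁻ (suc m) {m<n} (here refl) = s≤s (≤-reflexive (toℕ-fromℕ< m<n))
below-∈⁻ (suc m)       (there u∈)  = m<n⇒m<1+n (below-∈⁻ m u∈)

toℕ≡⇒fromℕ< : ∀ {m} {u : Fin n} (m<n : m < n) → toℕ u ≡ m → u ≡ fromℕ< m<n
toℕ≡⇒fromℕ< m<n e = toℕ-injective (trans e (sym (toℕ-fromℕ< m<n)))

below-∈⁺ : ∀ m {m≤n : m ≤ n} {u} → toℕ u < m → u ∈ below m m≤n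
below-∈⁺ (suc m) {m<n} {u} (s≤s u≤m) with m≤n⇒m<n∨m≡n u≤m
... | inj₁ u<m = there (below-∈⁺ m u<m)
... | inj₂ u≡m = here (toℕ≡⇒fromℕ< m<n u≡m)

below-∉ : ∀ m {m<n : m < n} → fromℕ< m<n ∉ below m (<⇒≤ m<n)
below-∉ m {m<n} u∈ = <-irrefl (toℕ-fromℕ< m<n) (below-∈⁻ m u∈)

below-unique : ∀ m {m≤n : m ≤ n} → Unique (below m m≤n)
below-unique zero    = []
below-unique (suc m) = ∉⇒unique-∷ (below-∉ m) (below-unique m)

-- The closing vertex `t` is kept general because the induction shortens the list while its closing
-- vertex stays the same.
below-zip⁻ : ∀ m {m<n : m < n} {t x y} → (x , y) ∈ zip (below (suc m) m<n) (below m (<⇒≤ m<n) ∷ʳ t) →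
             (suc (toℕ y) ≡ toℕ x × toℕ x < suc m) ⊎ (y ≡ t × toℕ x ≡ 0)
below-zip⁻ zero    {m<n} (here refl) = inj₂ (refl , toℕ-fromℕ< m<n)
below-zip⁻ (suc m) {m<n} (here refl) = inj₁
  ( trans (cong suc (toℕ-fromℕ< (<⇒≤ m<n))) (sym (toℕ-fromℕ< m<n))
  , s≤s (≤-reflexive (toℕ-fromℕ< m<n)))
below-zip⁻ (suc m) (there a∈) = Sum.map₁ (λ (e , x<) → e , m<n⇒m<1+n x<) (below-zip⁻ m a∈)

below-zip-step : ∀ m {m<n : m < n} {t x y} → suc (toℕ y) ≡ toℕ x → toℕ x < suc m →
                 (x , y) ∈ zip (below (suc m) m<n) (below m (<⇒≤ m<n) ∷ʳ t)
below-zip-step zero    {x = x} e x< with toℕ x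
below-zip-step zero () _ | zero
below-zip-step zero _ (s≤s ()) | suc _
below-zip-step (suc m) {m<n} e (s≤s x≤) with m≤n⇒m<n∨m≡n x≤
... | inj₁ x< = there (below-zip-step m e x<)
... | inj₂ x≡ = here (cong₂ _,_ (toℕ≡⇒fromℕ< m<n x≡) (toℕ≡⇒fromℕ< (<⇒≤ m<n) (suc-injective (trans e x≡))))

below-zip-last : ∀ m {m<n : m < n} {t x} → toℕ x ≡ 0 →
                 (x , t) ∈ zip (below (suc m) m<n) (below m (<⇒≤ m<n) ∷ʳ t)
below-zip-last zero    {m<n} e = here (cong (_, _) (toℕ≡⇒fromℕ< m<n e))
below-zip-last (suc m)       e = there (below-zip-last m e)

-- As `below` decreases, its arcs are those of `CycleArc` reversed; hence the exchanged `x` and `y`.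
below-induced : (G : Graph n) → ∀ l (l≤n : l ≤ n) →
  (∀ {x y} → CycleArc l (toℕ y) (toℕ x) → Adj G x y) →
  (∀ {x y} → toℕ x < l → toℕ y < l → Adj G x y → CycleArc l (toℕ x) (toℕ y) ⊎ CycleArc l (toℕ y) (toℕ x)) →
  Induced G (below l l≤n)
below-induced G zero    l≤n _   _   = record { distinct = [] ; arc⇒adj = λ () ; adj⇒arc = λ () }
below-induced G (suc m) l≤n to from = record
  { distinct = below-unique (suc m)
  ; arc⇒adj  = λ a∈ → to ([ inj₁ , (λ { (refl , e) → inj₂ (cong suc (toℕ-fromℕ< l≤n) , e) }) ]′ (below-zip⁻ m a∈))
  ; adj⇒arc  = λ x∈ y∈ e → [ inj₂ ∘ arc , inj₁ ∘ arc ]′ (from (below-∈⁻ (suc m) x∈) (below-∈⁻ (suc m) y∈) e)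
  }
  where
  arc : ∀ {x y} → CycleArc (suc m) (toℕ y) (toℕ x) → (x , y) ∈ arcs (below (suc m) l≤n)
  arc (inj₁ (e , x<)) = below-zip-step m e x<
  arc {x} (inj₂ (e , x≡0)) = subst (λ y → (x , y) ∈ arcs (below (suc m) l≤n))
    (sym (toℕ≡⇒fromℕ< l≤n (suc-injective e))) (below-zip-last m x≡0)

cycleArc-< : ∀ {l i j} → CycleArc l i j → i < l × j < l
cycleArc-< (inj₁ (refl , j<l))  = <⇒≤ j<l , j<l
cycleArc-< (inj₂ (refl , refl)) = ≤-refl , s≤s z≤n

-- Counts in `US` and `UP`, grown from the cycle on the numbers below `l`

module _ {n l : ℕ} (3≤l : 3 ≤ l) (l≤n : l ≤ n) where

  private
    0<l : 0 < l
    0<l = ≤-trans (s≤s z≤n) 3≤l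

    centre : Fin n
    centre = fromℕ< (≤-trans 0<l l≤n)

    toℕ-centre : toℕ centre ≡ 0
    toℕ-centre = toℕ-fromℕ< (≤-trans 0<l l≤n)

  centre-∈ : centre ∈ below l l≤n
  centre-∈ = below-∈⁺ l (subst (_< l) (sym toℕ-centre) 0<l)

  US-induced : Induced (US n l 3≤l) (below l l≤n)
  US-induced = below-induced (US n l 3≤l) l l≤n (inj₂ ∘ inj₁) λ x< y< →
    [ [ inj₁ , (λ (_ , l≤y) → contradiction (<-≤-trans y< l≤y) (<-irrefl refl)) ]′
    , [ inj₂ , (λ (_ , l≤x) → contradiction (<-≤-trans x< l≤x) (<-irrefl refl)) ]′ ]′

  UP-induced : Induced (UP n l 3≤l) (below l l≤n)
  UP-induced = below-induced (UP n l 3≤l) l l≤n (inj₂ ∘ inj₁) λ x< y< →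
    [ [ inj₁ , (λ (_ , l≤y) → contradiction (<-≤-trans y< l≤y) (<-irrefl refl)) ]′
    , [ inj₂ , (λ (_ , l≤x) → contradiction (<-≤-trans x< l≤x) (<-irrefl refl)) ]′ ]′

  module _ {k : ℕ} (k<n : k + l < n) where

    private
      v : Fin n
      v = fromℕ< k<n

      toℕ-v : toℕ v ≡ k + l
      toℕ-v = toℕ-fromℕ< k<n

      l≤v : l ≤ toℕ v
      l≤v = subst (l ≤_) (sym toℕ-v) (m≤n+m l k)

      v≮l : ¬ toℕ v < l
      v≮l v<l = <-irrefl refl (<-≤-trans v<l l≤v)

    US-leaf : Leaf (US n l 3≤l) (below (k + l) (<⇒≤ k<n)) v centre
    US-leaf = record
      { new  = below-∉ (k + l)
      ; old  = below-∈⁺ (k + l) (subst (_< k + l) (sym toℕ-centre) (≤-trans 0<l (m≤n+m l k)))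
      ; edge = inj₂ (inj₂ (toℕ-centre , l≤v))
      ; only = λ { x _ (inj₁ (inj₁ a))         → contradiction (proj₁ (cycleArc-< a)) v≮l
                 ; x _ (inj₁ (inj₂ (v≡0 , _))) → contradiction (subst (_< l) (sym v≡0) 0<l) v≮l
                 ; x _ (inj₂ (inj₁ a))         → contradiction (proj₂ (cycleArc-< a)) v≮l
                 ; x _ (inj₂ (inj₂ (x≡0 , _))) → toℕ-injective (trans x≡0 (sym toℕ-centre)) }
      }

    -- For `k = 0` the vertex `w` is the cycle vertex `l - 1` that carries the path; afterwards it
    -- is the previous end of the path.
    UP-leaf : ∀ w → suc (toℕ w) ≡ k + l → Leaf (UP n l 3≤l) (below (k + l) (<⇒≤ k<n)) v w
    UP-leaf w w+1 = record
      { new  = below-∉ (k + l)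
      ; old  = below-∈⁺ (k + l) (≤-reflexive w+1)
      ; edge = inj₂ (inj₂ (trans w+1 (sym toℕ-v) , l≤v))
      ; only = λ { x _  (inj₁ (inj₁ a))       → contradiction (proj₁ (cycleArc-< a)) v≮l
                 -- The next path vertex is adjacent to `v` too, but it has not been attached yet.
                 ; x x∈ (inj₁ (inj₂ (e , _))) → contradiction
                     (subst (_< k + l) (trans (sym e) (cong suc toℕ-v)) (below-∈⁻ (k + l) x∈))
                     (λ lt → <-irrefl refl (<⇒≤ lt))
                 ; x _  (inj₂ (inj₁ a))       → contradiction (proj₂ (cycleArc-< a)) v≮l
                 ; x _  (inj₂ (inj₂ (e , _))) → toℕ-injective
                     (suc-injective (trans e (trans toℕ-v (sym w+1)))) }
      }

    path-end : ∃ λ (w : Fin n) → suc (toℕ w) ≡ k + l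
    path-end = fromℕ< (<-trans p<k+l k<n) , trans (cong suc (toℕ-fromℕ< (<-trans p<k+l k<n))) p+1
      where
      p+1 : suc (pred (k + l)) ≡ k + l
      p+1 = suc-pred (k + l) {{>-nonZero (≤-trans 0<l (m≤n+m l k))}}
      p<k+l : pred (k + l) < k + l
      p<k+l = ≤-reflexive p+1

  module _ {b t : ℕ} (b≤ : b ≤ N (US n l 3≤l) (below l l≤n) [])
           (t≤ : t ≤ N (US n l 3≤l) (below l l≤n) (centre ∷ [])) where

    private
      G = US n l 3≤l

    US-rooted : ∀ k (k≤n : k + l ≤ n) → 2 ^ k * t ≤ N G (below (k + l) k≤n) (centre ∷ [])
    US-rooted zero    k≤n = ≤-trans (≤-reflexive (+-identityʳ t))
      -- `below l` carries a proof of its bound, and the base hypothesis was stated with another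
      -- proof of it.
      (subst (λ q → t ≤ N G (below l q) (centre ∷ [])) (≤-irrelevant l≤n k≤n) t≤)
    US-rooted (suc k) k<n = begin
      2 ^ suc k * t                                            ≡⟨ 2^1+k k t ⟩
      2 ^ k * t + 2 ^ k * t                                    ≤⟨ +-mono-≤ (US-rooted k (<⇒≤ k<n)) (US-rooted k (<⇒≤ k<n)) ⟩
      N G S (centre ∷ []) + N G S (centre ∷ [])                ≤⟨ +-monoʳ-≤ _ (N-leaf-≥ leaf) ⟩
      N G S (centre ∷ []) + N G (v ∷ S) (v ∷ centre ∷ [])      ≡⟨ sym (N-split (centre ∷ []) (Leaf.new leaf)) ⟩
      N G (v ∷ S) (centre ∷ [])                                ∎
      where
      open ≤-Reasoning
      S = below (k + l) (<⇒≤ k<n)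
      v = fromℕ< k<n
      leaf = US-leaf {k} k<n

    US-total : ∀ k (k≤n : k + l ≤ n) → upperTotal b t k ≤ N G (below (k + l) k≤n) []
    US-total zero    k≤n = subst (λ q → b ≤ N G (below l q) []) (≤-irrelevant l≤n k≤n) b≤
    US-total (suc k) k<n = subst (_ ≤_) (sym (N-total (US-leaf {k} k<n)))
      (+-mono-≤ (US-total k (<⇒≤ k<n)) (s≤s (US-rooted k (<⇒≤ k<n))))

  module _ {b t : ℕ} (≤b : N (UP n l 3≤l) (below l l≤n) [] ≤ b)
           (≤t : ∀ u → u ∈ below l l≤n → N (UP n l 3≤l) (below l l≤n) (u ∷ []) ≤ t) where

    private
      G = UP n l 3≤l

    UP-rooted : ∀ k (k≤n : k + l ≤ n) {w} → suc (toℕ w) ≡ k + l → N G (below (k + l) k≤n) (w ∷ []) ≤ k + t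
    UP-rooted zero    k≤n {w} e =
      subst (λ q → N G (below l q) (w ∷ []) ≤ t) (≤-irrelevant l≤n k≤n) (≤t w (below-∈⁺ l (≤-reflexive e)))
    UP-rooted (suc k) k<n {w} e with toℕ≡⇒fromℕ< k<n (suc-injective e) | path-end {k} k<n
    -- Now `w` is the leaf just attached, and its neighbour `w′` is the previous end of the path.
    ... | refl | w′ , e′ = subst (_≤ _) (sym (N-leaf (UP-leaf {k} k<n w′ e′))) (s≤s (UP-rooted k (<⇒≤ k<n) e′))

    UP-total : ∀ k (k≤n : k + l ≤ n) → N G (below (k + l) k≤n) [] ≤ lowerTotal b t k
    UP-total zero    k≤n = subst (λ q → N G (below l q) [] ≤ b) (≤-irrelevant l≤n k≤n) ≤b
    UP-total (suc k) k<n with path-end {k} k<n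
    ... | w , e = subst (_≤ _) (sym (N-total (UP-leaf {k} k<n w e)))
      (+-mono-≤ (UP-total k (<⇒≤ k<n)) (s≤s (UP-rooted k (<⇒≤ k<n) e)))

-- Comparison of the three graphs

nonempty-∈ : {xs : List A} → 1 ≤ length xs → ∃ (_∈ xs)
nonempty-∈ {xs = x ∷ _} _ = x , here refl

theorem2 : ∀ (n l : ℕ) (3≤l : 3 ≤ l) (l≤n : l ≤ n) (G : Graph n) (U : Unicyclic G) → girth U ≡ l →
    numSubtrees (US n l 3≤l) ≥ numSubtrees G × numSubtrees G ≥ numSubtrees (UP n l 3≤l)
theorem2 n l 3≤l l≤n G U refl = upper , lower
  where
  open Unicyclic U using (cycle; isCycle)
  m = n ∸ l
  m+l≡n : m + l ≡ n
  m+l≡n = m∸n+n≡m l≤n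
  m+l≤n = ≤-reflexive m+l≡n
  ind = unicyclic-induced U
  u∈ : ∃ (_∈ cycle)
  u∈ = nonempty-∈ (≤-trans (s≤s z≤n) 3≤l)
  sp = induced-spanned ind (proj₂ u∈)
  S = proj₁ (grow U (proj₂ u∈) sp m m+l≤n)
  grown : Grown G cycle m S
  grown = proj₂ (grow U (proj₂ u∈) sp m m+l≤n)
  t = N G cycle (proj₁ u∈ ∷ [])
  rooted : ∀ u → u ∈ cycle → N G cycle (u ∷ []) ≡ t
  -- The cycle is compared with itself: a rotation carries any of its vertices to any other.
  rooted u u∈c = ≤-antisym (N-induced-rooted ind ind refl u∈c (proj₂ u∈))
                           (N-induced-rooted ind ind refl (proj₂ u∈) u∈c)
  length-base : length cycle ≡ length (below l l≤n)
  length-base = sym (below-length l l≤n)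
  G-count : numSubtrees G ≡ suc (N G S [])
  G-count = numSubtrees-N G (grown-complete grown (IsCycle.distinct isCycle) m+l≡n)
  all-below : ∀ u → u ∈ below (m + l) m+l≤n
  all-below u = below-∈⁺ (m + l) (subst (toℕ u <_) (sym m+l≡n) (toℕ<n u))
  upper : numSubtrees G ≤ numSubtrees (US n l 3≤l)
  upper = subst₂ _≤_ (sym G-count) (sym (numSubtrees-N (US n l 3≤l) all-below)) (s≤s (≤-trans
    (total-upper sp rooted grown)
    (US-total 3≤l l≤n
      (N-induced-total ind (US-induced 3≤l l≤n) length-base)
      (N-induced-rooted ind (US-induced 3≤l l≤n) length-base (proj₂ u∈) (centre-∈ 3≤l l≤n))
      m m+l≤n)))
  lower : numSubtrees (UP n l 3≤l) ≤ numSubtrees G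
  lower = subst₂ _≤_ (sym (numSubtrees-N (UP n l 3≤l) all-below)) (sym G-count) (s≤s (≤-trans
    (UP-total 3≤l l≤n
      (N-induced-total (UP-induced 3≤l l≤n) ind (sym length-base))
      (λ u u∈′ → N-induced-rooted (UP-induced 3≤l l≤n) ind (sym length-base) u∈′ (proj₂ u∈))
      m m+l≤n)
    (total-lower sp rooted grown)))
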